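{- For every $s\ge2$ and every finite linear $P_4^s$-free $s$-uniform hypergraph $H$, $$|E(H)|\le\frac{s+1}{s}|V(H)|.$$ Equality holds if and only if $H$ has no isolated vertices and its edge-containing components are vertex-disjoint copies of $S(2,s,s^2)$.
   Context: A hypergraph is $s$-uniform if every edge has exactly $s$ vertices, and linear if any two distinct edges share at most one vertex. $P_4^s$ denotes the linear $s$-uniform hypergraph with four edges whose line graph (vertices are the edges, adjacency is intersection) is a path on four vertices, i.e. consecutive edges meet in exactly one vertex and nonconsecutive edges are disjoint. $H$ is $P_4^s$-free if no four of its edges form a copy of $P_4^s$. A Steiner system $S(2,s,s^2)$ is a hypergraph on $s^2$ points with blocks of size $s$ such that every pair of distinct points lies in exactly one block. -}

module Defs where

open import Data.Fin using (Fin)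
open import Data.Fin.Subset using (Subset; _∈_; _∉_; _⊆_; _∩_; ∣_∣; Nonempty; Empty)
open import Data.List using (List; []; _∷_; length)
import Data.List.Membership.Propositional as List
open import Data.List.Relation.Unary.Unique.Propositional using (Unique)
open import Data.Nat using (ℕ; _≤_)
open import Data.Product using (∃; ∃-syntax; ∃!; _×_)
open import Function.Bundles using (_⇔_)
open import Relation.Binary.Construct.Closure.ReflexiveTransitive using (Star)
open import Relation.Binary.PropositionalEquality using (_≡_; _≢_)
open import Relation.Nullary using (¬_)

-- The vertex set is Fin order. The edge set is a duplicate-free list, so its
-- cardinality is the length of the list.
record Hypergraph : Set where
  field
    order  : ℕ
    edges  : List (Subset order)
    unique : Unique edges

  Vertex : Set
  Vertex = Fin order

  IsEdge : Subset order → Set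
  IsEdge e = e List.∈ edges

  ∣V∣ : ℕ
  ∣V∣ = order

  ∣E∣ : ℕ
  ∣E∣ = length edges

open Hypergraph public using (∣V∣; ∣E∣)

module _ (H : Hypergraph) where
  open Hypergraph H hiding (∣V∣; ∣E∣)

  Uniform : ℕ → Set
  Uniform s = ∀ e → IsEdge e → ∣ e ∣ ≡ s

  Linear : Set
  Linear = ∀ e f → IsEdge e → IsEdge f → e ≢ f → ∣ e ∩ f ∣ ≤ 1

  Isolated : Vertex → Set
  Isolated v = ∀ e → IsEdge e → v ∉ e

  NoIsolatedVertices : Set
  NoIsolatedVertices = ∀ v → ¬ Isolated v

  Adjacent : Vertex → Vertex → Set
  Adjacent u v = ∃[ e ] IsEdge e × u ∈ e × v ∈ e

  Connected : Vertex → Vertex → Set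
  Connected = Star Adjacent

  -- Components are the classes of the equivalence relation Connected, so
  -- distinct components are automatically vertex-disjoint.
  IsComponent : Subset order → Set
  IsComponent C = Nonempty C × (∀ {u} → u ∈ C → ∀ v → v ∈ C ⇔ Connected u v)

  EdgeWithin : Subset order → Subset order → Set
  EdgeWithin C e = IsEdge e × e ⊆ C

  ContainsEdge : Subset order → Set
  ContainsEdge C = ∃ (EdgeWithin C)

-- Four edges forming a (not necessarily induced) copy of P₄ˢ, in path order.
record IsP₄ (s : ℕ) {n : ℕ} (e₁ e₂ e₃ e₄ : Subset n) : Set where
  field
    distinct    : Unique (e₁ ∷ e₂ ∷ e₃ ∷ e₄ ∷ [])
    size₁       : ∣ e₁ ∣ ≡ s
    size₂       : ∣ e₂ ∣ ≡ s
    size₃       : ∣ e₃ ∣ ≡ s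
    size₄       : ∣ e₄ ∣ ≡ s
    meet₁₂      : ∣ e₁ ∩ e₂ ∣ ≡ 1
    meet₂₃      : ∣ e₂ ∩ e₃ ∣ ≡ 1
    meet₃₄      : ∣ e₃ ∩ e₄ ∣ ≡ 1
    disjoint₁₃  : Empty (e₁ ∩ e₃)
    disjoint₁₄  : Empty (e₁ ∩ e₄)
    disjoint₂₄  : Empty (e₂ ∩ e₄)

P₄-Free : ℕ → Hypergraph → Set
P₄-Free s H = ∀ e₁ e₂ e₃ e₄ →
  IsEdge e₁ → IsEdge e₂ → IsEdge e₃ → IsEdge e₄ → ¬ IsP₄ s e₁ e₂ e₃ e₄
  where open Hypergraph H

-- The point set X with the blocks B is a Steiner system S(2,k,v).
record IsSteiner₂ (k v : ℕ) {n : ℕ} (X : Subset n) (B : Subset n → Set) : Set where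
  field
    points     : ∣ X ∣ ≡ v
    block⊆     : ∀ b → B b → b ⊆ X
    block-size : ∀ b → B b → ∣ b ∣ ≡ k
    pair       : ∀ {x y} → x ∈ X → y ∈ X → x ≢ y →
                 ∃! _≡_ (λ b → B b × x ∈ b × y ∈ b)

{-# OPTIONS --safe #-}

-- Since s ∣E∣ is the sum of the degrees, the bound says that the average degree
-- is at most s + 1. Let deg v ≥ s + 2, and let g avoid v and meet as many edges
-- through v as possible. If u ≠ v lies on an edge through v missed by g, then
-- P₄-freeness forces every other edge h through u to meet g, and then to meet
-- all edges through v missed by g. There are at least deg v − s ≥ 2 of these,
-- so deg u ≤ s, and the deficits of such points u overpay the excess of v.
--
-- Equality hence forces all degrees to be s + 1. Suppose that h avoids v, meets
-- an edge a ∋ v in x, and misses two edges b, b′ ∋ v. Each point u ≠ v of b lies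
-- on an edge missing b′; it is disjoint from h and meets more edges through v
-- than h does, so by induction it misses only b′. Counting incidences, such
-- edges are pairwise disjoint, so they carry b injectively into a without x,
-- which has fewer points. Hence h misses at most one edge through v, so all its
-- points are neighbours of v: adjacency is transitive, and the component of v
-- consists of the s² points on the edges through v.

module Submission where

open import Defs
open import Data.Bool using (true; false; if_then_else_)
import Data.Bool.Properties as Bool
open import Data.Empty using (⊥)
open import Data.Fin using (Fin; zero; suc)
import Data.Fin.Properties as Fin
open import Data.Fin.Subset as Subset using (Subset; ∣_∣; _∩_; _∪_; _-_; ⁅_⁆)
  renaming (_∈_ to _∈ˢ_; _∉_ to _∉ˢ_)
open import Data.Fin.Subset.Properties
  using ( drop-there; ∉⊥; ∣⊥∣≡0; ∣p∣≤n; Empty-unique; x∈⁅x⁆; x∈⁅y⁆⇒x≡y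
        ; x∈p∩q⁺; x∈p∩q⁻; ∩-idem; ∣p∩q∣≤∣q∣; p⊆p∪q; q⊆p∪q; x∈p∪q⁻; p⊂q⇒∣p∣<∣q∣
        ; p─q⊆p; x∈p∧x≢y⇒x∈p-y; x∈p⇒∣p-x∣<∣p∣)
  renaming (_∈?_ to _∈ˢ?_)
import Data.Integer as ℤ
import Data.Integer.Properties as ℤ
open import Data.List using (List; []; _∷_; length; map; filter; allFin; tabulate; lookup)
open import Data.List.Membership.Propositional using (_∈_; find; lose)
open import Data.List.Membership.Propositional.Properties using (∈-lookup; ∈-allFin; ∈-filter⁺; ∈-filter⁻)
import Data.List.Membership.Setoid.Properties as Setoid
open import Data.List.Properties using (map-tabulate; length-tabulate)
open import Data.List.Relation.Unary.All as All using ([]; _∷_)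
open import Data.List.Relation.Unary.AllPairs using ([]; _∷_)
open import Data.List.Relation.Unary.Any as Any using (here; there)
open import Data.List.Relation.Unary.Unique.Propositional using (Unique)
open import Data.List.Relation.Unary.Unique.Propositional.Properties using (allFin⁺; filter⁺)
open import Data.Nat using (ℕ; zero; suc; _+_; _*_; _^_; _≤_; _<_; _≤?_; z≤n; s≤s; s≤s⁻¹; >-nonZero)
open import Data.Nat.ListAction using (sum)
open import Data.Nat.Properties
open import Data.List.Extrema ≤-totalOrder using (argmax; argmax-sel; f[xs]≤f[argmax])
open import Data.Nat.Solver using (module +-*-Solver)
open import Data.Product using (∃; ∃-syntax; _×_; _,_; proj₁; proj₂)
open import Data.Rational as ℚ using (_/_; toℚᵘ)
open import Data.Rational.Properties
  using (toℚᵘ-fromℚᵘ; toℚᵘ-homo-*; toℚᵘ-cancel-≤; toℚᵘ-cong; toℚᵘ-injective)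
open import Data.Rational.Unnormalised as ℚᵘ using (mkℚᵘ)
import Data.Rational.Unnormalised.Properties as ℚᵘ
open import Data.Sum using (_⊎_; inj₁; inj₂)
open import Data.Unit using (⊤; tt)
open import Data.Vec using ([]; _∷_; here; there)
open import Data.Vec.Properties using (≡-dec)
open import Function using (_∘_; id; _$_)
open import Function.Bundles using (_⇔_; mk⇔; Equivalence)
open import Relation.Binary.Construct.Closure.ReflexiveTransitive as Star using (ε; _◅_; _◅◅_)
open import Relation.Binary.Definitions using (DecidableEquality)
open import Relation.Binary.PropositionalEquality
open import Relation.Nullary using (Dec; yes; no; does; ¬_; contradiction)
open import Relation.Nullary.Decidable using (¬?; _×-dec_; _→-dec_; decidable-stable; map′)
open import Relation.Unary using (Decidable)
open +-*-Solver using (solve; _:+_; _:*_; _:=_; con)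

-- Finite sums and counting

private variable
  A B : Set
  P : A → Set
  n : ℕ

𝟙 : Dec A → ℕ
𝟙 a? = if does a? then 1 else 0

𝟙-yes : (a? : Dec A) → A → 𝟙 a? ≡ 1
𝟙-yes (yes _) _ = refl
𝟙-yes (no ¬a) a = contradiction a ¬a

𝟙-no : (a? : Dec A) → ¬ A → 𝟙 a? ≡ 0
𝟙-no (yes a) ¬a = contradiction a ¬a
𝟙-no (no _)  _  = refl

𝟙-mono : (a? : Dec A) (b? : Dec B) → (A → B) → 𝟙 a? ≤ 𝟙 b?
𝟙-mono (no _)  b? f = z≤n
𝟙-mono (yes a) b? f = ≤-reflexive (sym (𝟙-yes b? (f a)))

𝟙-cong : (a? : Dec A) (b? : Dec B) → (A → B) → (B → A) → 𝟙 a? ≡ 𝟙 b?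
𝟙-cong a? b? f g = ≤-antisym (𝟙-mono a? b? f) (𝟙-mono b? a? g)

𝟙-× : (a? : Dec A) (b? : Dec B) → 𝟙 (a? ×-dec b?) ≡ 𝟙 a? * 𝟙 b?
𝟙-× (no _)  b? = refl
𝟙-× (yes _) b? with does b?
... | true  = refl
... | false = refl

∑ : List A → (A → ℕ) → ℕ
∑ xs f = sum (map f xs)

∑-mono : ∀ xs {f g : A → ℕ} → (∀ {x} → x ∈ xs → f x ≤ g x) → ∑ xs f ≤ ∑ xs g
∑-mono []       f≤g = z≤n
∑-mono (x ∷ xs) f≤g = +-mono-≤ (f≤g (here refl)) (∑-mono xs (f≤g ∘ there))

∑-cong : ∀ xs {f g : A → ℕ} → (∀ {x} → x ∈ xs → f x ≡ g x) → ∑ xs f ≡ ∑ xs g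
∑-cong []       f≡g = refl
∑-cong (x ∷ xs) f≡g = cong₂ _+_ (f≡g (here refl)) (∑-cong xs (f≡g ∘ there))

+-tight : ∀ {a b c d} → a ≤ c → b ≤ d → c + d ≤ a + b → c ≤ a × d ≤ b
+-tight {a} {b} {c} {d} a≤c b≤d h =
  +-cancelʳ-≤ b c a (≤-trans (+-monoʳ-≤ c b≤d) h) ,
  +-cancelˡ-≤ a d b (≤-trans (+-monoˡ-≤ d a≤c) h)

-- No slack in the total leaves none in any term. Both the passage from equality to regularity and
-- `parallel-sym` rest on this.
∑-tight : ∀ xs {f g : A → ℕ} → (∀ {x} → x ∈ xs → f x ≤ g x) → ∑ xs g ≤ ∑ xs f →
          ∀ {x} → x ∈ xs → f x ≡ g x
∑-tight (x ∷ xs) f≤g h x∈ with +-tight (f≤g (here refl)) (∑-mono xs (f≤g ∘ there)) h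
∑-tight (x ∷ xs) f≤g h (here refl) | gx≤fx , _ = ≤-antisym (f≤g (here refl)) gx≤fx
∑-tight (x ∷ xs) f≤g h (there x∈)  | _ , h′    = ∑-tight xs (f≤g ∘ there) h′ x∈

∑-+ : ∀ xs (f g : A → ℕ) → ∑ xs (λ x → f x + g x) ≡ ∑ xs f + ∑ xs g
∑-+ []       f g = refl
∑-+ (x ∷ xs) f g rewrite ∑-+ xs f g =
  solve 4 (λ a b c d → (a :+ b) :+ (c :+ d) := (a :+ c) :+ (b :+ d)) refl
    (f x) (g x) (∑ xs f) (∑ xs g)

∑-*ʳ : ∀ xs (f : A → ℕ) k → ∑ xs (λ x → f x * k) ≡ ∑ xs f * k
∑-*ʳ []       f k = refl
∑-*ʳ (x ∷ xs) f k rewrite ∑-*ʳ xs f k = sym (*-distribʳ-+ k (f x) (∑ xs f))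

∑-const : ∀ (xs : List A) k → ∑ xs (λ _ → k) ≡ length xs * k
∑-const []       k = refl
∑-const (x ∷ xs) k = cong (k +_) (∑-const xs k)

∑-swap : ∀ (xs : List A) (ys : List B) (f : A → B → ℕ) →
         ∑ xs (λ x → ∑ ys (f x)) ≡ ∑ ys (λ y → ∑ xs (λ x → f x y))
∑-swap []       ys f = sym (trans (∑-const ys 0) (*-zeroʳ (length ys)))
∑-swap (x ∷ xs) ys f rewrite ∑-swap xs ys f = sym (∑-+ ys (f x) _)

length-filter≡∑ : (P? : Decidable P) (xs : List A) → length (filter P? xs) ≡ ∑ xs (𝟙 ∘ P?)
length-filter≡∑ P? []       = refl
length-filter≡∑ P? (x ∷ xs) with does (P? x)
... | true  = cong suc (length-filter≡∑ P? xs)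
... | false = length-filter≡∑ P? xs

∑-filter : (P? : Decidable P) (xs : List A) (f : A → ℕ) →
           ∑ (filter P? xs) f ≡ ∑ xs (λ x → 𝟙 (P? x) * f x)
∑-filter P? []       f = refl
∑-filter P? (x ∷ xs) f with does (P? x)
... | true  = cong₂ _+_ (sym (+-identityʳ (f x))) (∑-filter P? xs f)
... | false = ∑-filter P? xs f

length-filter-¬ : (P? : Decidable P) (xs : List A) →
                  length (filter P? xs) + length (filter (¬? ∘ P?) xs) ≡ length xs
length-filter-¬ P? []       = refl
length-filter-¬ P? (x ∷ xs) with does (P? x)
... | true  = cong suc (length-filter-¬ P? xs)
... | false = trans (+-suc _ _) (cong suc (length-filter-¬ P? xs))

lookup-injective : {xs : List A} → Unique xs → ∀ i j → lookup xs i ≡ lookup xs j → i ≡ j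
lookup-injective (x∉ ∷ u) zero    zero    eq = refl
lookup-injective (x∉ ∷ u) zero    (suc j) eq = contradiction eq (All.lookup x∉ (∈-lookup j))
lookup-injective (x∉ ∷ u) (suc i) zero    eq = contradiction (sym eq) (All.lookup x∉ (∈-lookup i))
lookup-injective (x∉ ∷ u) (suc i) (suc j) eq = cong suc (lookup-injective u i j eq)

-- The pairing is a relation because partners are usually chosen from a membership proof, so that no
-- function on `A` is at hand. List positions turn it into an injection between finite types.
length-injection : {xs : List A} {ys : List B} (R : A → B → Set) → Unique xs →
  (∀ {x} → x ∈ xs → ∃[ y ] y ∈ ys × R x y) →
  (∀ {x x′ y} → x ∈ xs → x′ ∈ xs → R x y → R x′ y → x ≡ x′) →
  length xs ≤ length ys
length-injection {B = B} {xs = xs} {ys} R u total inj = Fin.injective⇒≤ {f = f} f-inj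
  where
  f : Fin (length xs) → Fin (length ys)
  f i = Any.index (proj₁ (proj₂ (total (∈-lookup i))))
  f-inj : ∀ {i j} → f i ≡ f j → i ≡ j
  f-inj {i} {j} eq with total (∈-lookup {xs = xs} i) | total (∈-lookup {xs = xs} j)
  ... | y , y∈ , Rxy | y′ , y′∈ , Rxy′ with Setoid.index-injective (setoid B) y∈ y′∈ eq
  ... | refl = lookup-injective u i j (inj (∈-lookup i) (∈-lookup j) Rxy Rxy′)

length-⊆ : {xs ys : List A} → Unique xs → (∀ {x} → x ∈ xs → x ∈ ys) → length xs ≤ length ys
length-⊆ u ⊆ = length-injection _≡_ u (λ {x} x∈ → x , ⊆ x∈ , refl)
  λ { _ _ refl refl → refl }

length-⊂ : {xs ys : List A} {a : A} → Unique xs → (∀ {x} → x ∈ xs → x ∈ ys) →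
           ¬ a ∈ xs → a ∈ ys → length xs < length ys
length-⊂ {xs = xs} {a = a} u ⊆ a∉ a∈ = length-⊆ (All.tabulate (λ { x∈ refl → a∉ x∈ }) ∷ u)
  λ { (here refl) → a∈ ; (there x∈) → ⊆ x∈ }

∑-𝟙≤1 : (P? : Decidable P) {xs : List A} → Unique xs →
        (∀ {x y} → x ∈ xs → y ∈ xs → P x → P y → x ≡ y) → ∑ xs (𝟙 ∘ P?) ≤ 1
∑-𝟙≤1 {P = P} P? {xs} u amo = subst (_≤ 1) (length-filter≡∑ P? xs) $
  length-injection {ys = tt ∷ []} (λ _ _ → ⊤) (filter⁺ P? u) (λ _ → tt , here refl , tt)
    λ x∈ y∈ _ _ → let x∈xs , Px = ∈-filter⁻ P? x∈ ; y∈xs , Py = ∈-filter⁻ P? y∈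
                  in amo x∈xs y∈xs Px Py

∑-𝟙≡1 : (P? : Decidable P) {xs : List A} {a : A} → Unique xs → a ∈ xs → P a →
        (∀ {x y} → x ∈ xs → y ∈ xs → P x → P y → x ≡ y) → ∑ xs (𝟙 ∘ P?) ≡ 1
∑-𝟙≡1 P? {xs} {a} u a∈ Pa amo = ≤-antisym (∑-𝟙≤1 P? u amo) $
  subst (1 ≤_) (length-filter≡∑ P? xs) $
  length-⊆ {xs = a ∷ []} ([] ∷ []) λ { (here refl) → ∈-filter⁺ P? a∈ Pa }

∣p∣≡∑ : (p : Subset n) → ∣ p ∣ ≡ ∑ (allFin n) (λ x → 𝟙 (x ∈ˢ? p))
∣p∣≡∑ []      = refl
∣p∣≡∑ {suc n} (b ∷ p) = trans (lemma b) $ cong (𝟙 (zero ∈ˢ? (b ∷ p)) +_) (begin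
  ∑ (allFin n) (λ x → 𝟙 (x ∈ˢ? p))
    ≡⟨ ∑-cong (allFin n) (λ {x} _ → 𝟙-cong (x ∈ˢ? p) (suc x ∈ˢ? (b ∷ p)) there drop-there) ⟩
  ∑ (allFin n) (λ x → 𝟙 (suc x ∈ˢ? (b ∷ p)))
    ≡⟨ cong sum (trans (map-tabulate (λ x → x) at-suc) (sym (map-tabulate Fin.suc at))) ⟩
  ∑ (tabulate suc) (λ x → 𝟙 (x ∈ˢ? (b ∷ p))) ∎)
  where
  open ≡-Reasoning
  at : Fin (suc n) → ℕ
  at x = 𝟙 (x ∈ˢ? (b ∷ p))
  at-suc : Fin n → ℕ
  at-suc x = at (suc x)
  lemma : ∀ b → ∣ b ∷ p ∣ ≡ 𝟙 (zero ∈ˢ? (b ∷ p)) + ∑ (allFin n) (λ x → 𝟙 (x ∈ˢ? p))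
  lemma true  = cong suc (∣p∣≡∑ p)
  lemma false = ∣p∣≡∑ p

elements : Subset n → List (Fin n)
elements p = filter (_∈ˢ? p) (allFin _)

length-elements : (p : Subset n) → length (elements p) ≡ ∣ p ∣
length-elements p = trans (length-filter≡∑ (_∈ˢ? p) (allFin _)) (sym (∣p∣≡∑ p))

elements-unique : (p : Subset n) → Unique (elements p)
elements-unique p = filter⁺ (_∈ˢ? p) (allFin⁺ _)

∈-elements⁺ : {p : Subset n} {x : Fin n} → x ∈ˢ p → x ∈ elements p
∈-elements⁺ {p = p} {x} = ∈-filter⁺ (_∈ˢ? p) (∈-allFin x)

∈-elements⁻ : {p : Subset n} {x : Fin n} → x ∈ elements p → x ∈ˢ p
∈-elements⁻ {p = p} = proj₂ ∘ ∈-filter⁻ (_∈ˢ? p) {xs = allFin _}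

∣p∣≤1⇒≡ : {p : Subset n} → ∣ p ∣ ≤ 1 → ∀ {x y} → x ∈ˢ p → y ∈ˢ p → x ≡ y
∣p∣≤1⇒≡ {p = p} p≤1 {x} {y} x∈ y∈ with x Fin.≟ y
... | yes x≡y = x≡y
... | no  x≢y = contradiction p≤1 (<⇒≱ (subst (2 ≤_) (length-elements p)
  (length-⊆ {xs = x ∷ y ∷ []} ((x≢y ∷ []) ∷ [] ∷ [])
    λ { (here refl) → ∈-elements⁺ x∈ ; (there (here refl)) → ∈-elements⁺ y∈ })))

∑-filter-≤ : (P? : Decidable P) (xs : List A) (f : A → ℕ) → ∑ (filter P? xs) f ≤ ∑ xs f
∑-filter-≤ P? []       f = z≤n
∑-filter-≤ P? (x ∷ xs) f with does (P? x)
... | true  = +-monoʳ-≤ (f x) (∑-filter-≤ P? xs f)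
... | false = ≤-trans (∑-filter-≤ P? xs f) (m≤n+m _ (f x))

element : {xs : List A} → 1 ≤ length xs → ∃[ a ] a ∈ xs
element {xs = x ∷ _} _ = x , here refl

distinct-pair : {xs : List A} → Unique xs → 2 ≤ length xs → ∃[ a ] ∃[ b ] a ∈ xs × b ∈ xs × a ≢ b
distinct-pair {xs = _ ∷ []}    _ (s≤s ())
distinct-pair {xs = x ∷ y ∷ _} ((x≢y ∷ _) ∷ _) _ = x , y , here refl , there (here refl) , x≢y

another : {xs : List A} → DecidableEquality A → Unique xs → 2 ≤ length xs → ∀ a →
          ∃[ b ] b ∈ xs × b ≢ a
another _≟_ u 2≤ a with distinct-pair u 2≤
... | b , c , b∈ , c∈ , b≢c with b ≟ a
... | yes refl = c , c∈ , b≢c ∘ sym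
... | no b≢a   = b , b∈ , b≢a

-- Incidence in hypergraphs

_≟ˢ_ : DecidableEquality (Subset n)
_≟ˢ_ = ≡-dec Bool._≟_

Meets : Subset n → Subset n → Set
Meets e f = ∃[ x ] x ∈ˢ e × x ∈ˢ f

Meets? : (e f : Subset n) → Dec (Meets e f)
Meets? e f = Fin.any? λ x → (x ∈ˢ? e) ×-dec (x ∈ˢ? f)

Meets-sym : {e f : Subset n} → Meets e f → Meets f e
Meets-sym (x , x∈e , x∈f) = x , x∈f , x∈e

module _ (H : Hypergraph) where
  open Hypergraph H using (order; edges; unique; Vertex; IsEdge)

  star : Vertex → List (Subset order)
  star v = filter (v ∈ˢ?_) edges

  deg : Vertex → ℕ
  deg v = length (star v)

  star-unique : ∀ v → Unique (star v)
  star-unique v = filter⁺ (v ∈ˢ?_) unique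

  ∈-star⁺ : ∀ {v e} → IsEdge e → v ∈ˢ e → e ∈ star v
  ∈-star⁺ {v} = ∈-filter⁺ (v ∈ˢ?_)

  ∈-star⁻ : ∀ {v e} → e ∈ star v → IsEdge e × v ∈ˢ e
  ∈-star⁻ {v} = ∈-filter⁻ (v ∈ˢ?_)

  hits misses : Vertex → Subset order → List (Subset order)
  hits   v h = filter (Meets? h) (star v)
  misses v h = filter (¬? ∘ Meets? h) (star v)

  hits+misses≡deg : ∀ v h → length (hits v h) + length (misses v h) ≡ deg v
  hits+misses≡deg v h = length-filter-¬ (Meets? h) (star v)

  ∈-hits⁺ : ∀ {v h e} → IsEdge e → v ∈ˢ e → Meets h e → e ∈ hits v h
  ∈-hits⁺ {v} {h} e-edge v∈e = ∈-filter⁺ (Meets? h) (∈-star⁺ e-edge v∈e)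

  ∈-hits⁻ : ∀ {v h e} → e ∈ hits v h → (IsEdge e × v ∈ˢ e) × Meets h e
  ∈-hits⁻ {v} {h} e∈ with e∈star , m ← ∈-filter⁻ (Meets? h) e∈ = ∈-star⁻ e∈star , m

  ∈-misses⁺ : ∀ {v h e} → IsEdge e → v ∈ˢ e → ¬ Meets h e → e ∈ misses v h
  ∈-misses⁺ {v} {h} e-edge v∈e = ∈-filter⁺ (¬? ∘ Meets? h) (∈-star⁺ e-edge v∈e)

  ∈-misses⁻ : ∀ {v h e} → e ∈ misses v h → (IsEdge e × v ∈ˢ e) × ¬ Meets h e
  ∈-misses⁻ {v} {h} e∈ with e∈star , m ← ∈-filter⁻ (¬? ∘ Meets? h) e∈ = ∈-star⁻ e∈star , m

  hits-unique : ∀ v h → Unique (hits v h)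
  hits-unique v h = filter⁺ (Meets? h) (star-unique v)

  misses-unique : ∀ v h → Unique (misses v h)
  misses-unique v h = filter⁺ (¬? ∘ Meets? h) (star-unique v)

  -- Double counting of incidences, each weighted by its vertex. The constant `1` gives the degree
  -- sum, `charge` the total of all payments, and the indicator of an edge the sum of its
  -- intersection sizes.
  ∑-incidence : (c : Vertex → ℕ) → ∑ edges (λ e → ∑ (elements e) c) ≡ ∑ (allFin order) (λ v → deg v * c v)
  ∑-incidence c = begin
    ∑ edges (λ e → ∑ (elements e) c)
      ≡⟨ ∑-cong edges (λ {e} _ → ∑-filter (_∈ˢ? e) (allFin order) c) ⟩
    ∑ edges (λ e → ∑ (allFin order) (λ v → 𝟙 (v ∈ˢ? e) * c v))
      ≡⟨ ∑-swap edges (allFin order) _ ⟩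
    ∑ (allFin order) (λ v → ∑ edges (λ e → 𝟙 (v ∈ˢ? e) * c v))
      ≡⟨ ∑-cong (allFin order) (λ {v} _ → trans (∑-*ʳ edges _ (c v))
           (cong (_* c v) (sym (length-filter≡∑ (v ∈ˢ?_) edges)))) ⟩
    ∑ (allFin order) (λ v → deg v * c v) ∎
    where open ≡-Reasoning

  module _ {s : ℕ} (uniform : Uniform H s) where

    ∑-deg : ∑ (allFin order) deg ≡ s * ∣E∣ H
    ∑-deg = begin
      ∑ (allFin order) deg                     ≡⟨ ∑-cong (allFin order) (λ {v} _ → sym (*-identityʳ (deg v))) ⟩
      ∑ (allFin order) (λ v → deg v * 1)       ≡⟨ ∑-incidence (λ _ → 1) ⟨
      ∑ edges (λ e → ∑ (elements e) (λ _ → 1)) ≡⟨ ∑-cong edges (λ {e} e-edge →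
        trans (∑-const (elements e) 1) (trans (*-identityʳ _) (trans (length-elements e) (uniform e e-edge)))) ⟩
      ∑ edges (λ _ → s)                        ≡⟨ ∑-const edges s ⟩
      ∣E∣ H * s                                ≡⟨ *-comm (∣E∣ H) s ⟩
      s * ∣E∣ H                                ∎
      where open ≡-Reasoning

  Adjacent? : ∀ u v → Dec (Adjacent H u v)
  Adjacent? u v = map′ find (λ (e , e-edge , uv) → lose e-edge uv)
    (Any.any? (λ e → (u ∈ˢ? e) ×-dec (v ∈ˢ? e)) edges)

  module _ (linear : Linear H) where

    same-vertex : ∀ {e f x y} → IsEdge e → IsEdge f → e ≢ f →
                  x ∈ˢ e → x ∈ˢ f → y ∈ˢ e → y ∈ˢ f → x ≡ y
    same-vertex {e} {f} e-edge f-edge e≢f x∈e x∈f y∈e y∈f =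
      ∣p∣≤1⇒≡ (linear e f e-edge f-edge e≢f) (x∈p∩q⁺ (x∈e , x∈f)) (x∈p∩q⁺ (y∈e , y∈f))

    same-edge : ∀ {e f x y} → IsEdge e → IsEdge f → x ≢ y →
                x ∈ˢ e → x ∈ˢ f → y ∈ˢ e → y ∈ˢ f → e ≡ f
    same-edge {e} {f} e-edge f-edge x≢y x∈e x∈f y∈e y∈f = decidable-stable (e ≟ˢ f)
      λ e≢f → x≢y (same-vertex e-edge f-edge e≢f x∈e x∈f y∈e y∈f)

    meet-size : ∀ {e f} → IsEdge e → IsEdge f → e ≢ f → Meets e f → ∣ e ∩ f ∣ ≡ 1
    meet-size {e} {f} e-edge f-edge e≢f (x , x∈e , x∈f) =
      ≤-antisym (linear e f e-edge f-edge e≢f) $ subst (1 ≤_) (length-elements (e ∩ f)) $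
      length-⊆ {xs = x ∷ []} ([] ∷ []) λ { (here refl) → ∈-elements⁺ (x∈p∩q⁺ (x∈e , x∈f)) }

    -- Each hit is assigned a point shared with `h`; by linearity no point other than `v` lies on
    -- two edges through `v`. Here `h` is any set, so the bound also serves for an edge with one
    -- point removed.
    hits≤ : ∀ {v h} → v ∉ˢ h → length (hits v h) ≤ ∣ h ∣
    hits≤ {v} {h} v∉h = subst (length (hits v h) ≤_) (length-elements h) $
      length-injection (λ e y → y ∈ˢ h × y ∈ˢ e) (hits-unique v h)
        (λ e∈ → let _ , y , y∈h , y∈e = ∈-hits⁻ e∈ in y , ∈-elements⁺ y∈h , y∈h , y∈e)
        λ e∈ e′∈ (y∈h , y∈e) (_ , y∈e′) →
          let (e-edge , v∈e) , _ = ∈-hits⁻ e∈ ; (e′-edge , v∈e′) , _ = ∈-hits⁻ e′∈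
          in same-edge e-edge e′-edge (λ { refl → v∉h y∈h }) v∈e v∈e′ y∈e y∈e′

    -- Consequences of P₄-freeness

    module _ {s : ℕ} (uniform : Uniform H s) (free : P₄-Free s H) where

      -- Distinctness is automatic: any coincidence would turn a prescribed intersection into a
      -- forbidden one. The sizes of the intersections come from linearity.
      no-P₄ : ∀ {e₁ e₂ e₃ e₄} → IsEdge e₁ → IsEdge e₂ → IsEdge e₃ → IsEdge e₄ →
              Meets e₁ e₂ → Meets e₂ e₃ → Meets e₃ e₄ →
              ¬ Meets e₁ e₃ → ¬ Meets e₁ e₄ → ¬ Meets e₂ e₄ → ⊥
      no-P₄ {e₁} {e₂} {e₃} {e₄} i₁ i₂ i₃ i₄ m₁₂ m₂₃ m₃₄ d₁₃ d₁₄ d₂₄ = free e₁ e₂ e₃ e₄ i₁ i₂ i₃ i₄ record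
        { distinct  = (e₁≢e₂ ∷ e₁≢e₃ ∷ e₁≢e₄ ∷ []) ∷ (e₂≢e₃ ∷ e₂≢e₄ ∷ []) ∷ (e₃≢e₄ ∷ []) ∷ [] ∷ []
        ; size₁     = uniform e₁ i₁
        ; size₂     = uniform e₂ i₂
        ; size₃     = uniform e₃ i₃
        ; size₄     = uniform e₄ i₄
        ; meet₁₂    = meet-size i₁ i₂ e₁≢e₂ m₁₂
        ; meet₂₃    = meet-size i₂ i₃ e₂≢e₃ m₂₃
        ; meet₃₄    = meet-size i₃ i₄ e₃≢e₄ m₃₄
        ; disjoint₁₃ = λ (x , x∈) → d₁₃ (x , x∈p∩q⁻ e₁ e₃ x∈)
        ; disjoint₁₄ = λ (x , x∈) → d₁₄ (x , x∈p∩q⁻ e₁ e₄ x∈)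
        ; disjoint₂₄ = λ (x , x∈) → d₂₄ (x , x∈p∩q⁻ e₂ e₄ x∈)
        }
        where
        e₁≢e₂ : e₁ ≢ e₂
        e₁≢e₂ refl = d₁₃ m₂₃
        e₁≢e₃ : e₁ ≢ e₃
        e₁≢e₃ refl = d₁₄ m₃₄
        e₁≢e₄ : e₁ ≢ e₄
        e₁≢e₄ refl = d₁₃ (Meets-sym m₃₄)
        e₂≢e₃ : e₂ ≢ e₃
        e₂≢e₃ refl = d₂₄ m₃₄
        e₂≢e₄ : e₂ ≢ e₄
        e₂≢e₄ refl = d₁₄ m₁₂
        e₃≢e₄ : e₃ ≢ e₄
        e₃≢e₄ refl = d₂₄ m₂₃

      -- Every edge in the star of `u` is then a hit, so `hits≤` bounds the whole star.
      all-meet⇒deg≤s : ∀ {u f} → IsEdge f → u ∉ˢ f → (∀ {e} → IsEdge e → u ∈ˢ e → Meets f e) → deg u ≤ s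
      all-meet⇒deg≤s {u} {f} f-edge u∉f meets = subst (deg u ≤_) (uniform f f-edge) $
        ≤-trans (length-⊆ (star-unique u) λ e∈ → let e-edge , u∈e = ∈-star⁻ e∈ in
          ∈-hits⁺ e-edge u∈e (meets e-edge u∈e)) (hits≤ u∉f)

      -- Otherwise h, a, b, g form a P₄.
      hits-⊆ : ∀ {v a g h} → IsEdge a → IsEdge g → IsEdge h → v ∈ˢ a →
               Meets h a → ¬ Meets g a → ¬ Meets h g →
               ∀ {b} → b ∈ hits v g → b ∈ hits v h
      hits-⊆ {v} {a} {g} {h} a-edge g-edge h-edge v∈a h-a g∦a h∦g {b} b∈
        with (b-edge , v∈b) , g-b ← ∈-hits⁻ b∈ =
        ∈-hits⁺ b-edge v∈b $ decidable-stable (Meets? h b) λ h∦b →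
          no-P₄ h-edge a-edge b-edge g-edge h-a (v , v∈a , v∈b) (Meets-sym g-b)
            h∦b h∦g (g∦a ∘ Meets-sym)

      -- Otherwise b, a, h, g form a P₄.
      both-missed⇒disjoint : ∀ {v a b g h} → IsEdge a → IsEdge b → IsEdge g → IsEdge h →
        v ∈ˢ a → v ∈ˢ b → Meets h a → ¬ Meets h b → ¬ Meets g a → ¬ Meets g b → ¬ Meets h g
      both-missed⇒disjoint {v} a-edge b-edge g-edge h-edge v∈a v∈b h-a h∦b g∦a g∦b h-g =
        no-P₄ b-edge a-edge h-edge g-edge (v , v∈b , v∈a) (Meets-sym h-a) h-g
          (h∦b ∘ Meets-sym) (g∦b ∘ Meets-sym) (g∦a ∘ Meets-sym)

      -- Vertices of degree at least s + 2

      -- g may be empty, which covers the case that every edge contains v.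
      record MaximalCrosser (v : Vertex) (g : Subset order) : Set where
        field
          avoids  : v ∉ˢ g
          size    : ∣ g ∣ ≤ s
          is-edge : ∀ {x} → x ∈ˢ g → IsEdge g
          maximal : ∀ {h} → IsEdge h → v ∉ˢ h → length (hits v h) ≤ length (hits v g)

      maximalCrosser : ∀ v → ∃ (MaximalCrosser v)
      maximalCrosser v = g , go (argmax-sel hit-count Subset.⊥ candidates)
        where
        hit-count : Subset order → ℕ
        hit-count h = length (hits v h)
        v∉? = λ e → ¬? (v ∈ˢ? e)
        candidates = filter v∉? edges
        g = argmax hit-count Subset.⊥ candidates
        g-max : ∀ {h} → IsEdge h → v ∉ˢ h → hit-count h ≤ hit-count g
        g-max h-edge v∉h = All.lookup (f[xs]≤f[argmax] Subset.⊥ candidates)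
          (∈-filter⁺ v∉? h-edge v∉h)
        go : g ≡ Subset.⊥ ⊎ g ∈ candidates → MaximalCrosser v g
        go (inj₁ g≡⊥) = record
          { avoids  = ∉⊥ ∘ subst (v ∈ˢ_) g≡⊥
          ; size    = subst (_≤ s) (sym (trans (cong ∣_∣ g≡⊥) (∣⊥∣≡0 order))) z≤n
          ; is-edge = λ x∈g → contradiction (subst (_ ∈ˢ_) g≡⊥ x∈g) ∉⊥
          ; maximal = g-max
          }
        go (inj₂ g∈) with g-edge , v∉g ← ∈-filter⁻ v∉? {xs = edges} g∈ = record
          { avoids  = v∉g
          ; size    = ≤-reflexive (uniform g g-edge)
          ; is-edge = λ _ → g-edge
          ; maximal = g-max
          }

      module HighDegree {v g} (crosser : MaximalCrosser v g) (high : 2 + s ≤ deg v) where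
        open MaximalCrosser crosser

        α : ℕ
        α = length (misses v g)

        deg≤α+s : deg v ≤ α + s
        deg≤α+s = begin
          deg v            ≡⟨ hits+misses≡deg v g ⟨
          length (hits v g) + α ≤⟨ +-monoˡ-≤ α (≤-trans (hits≤ avoids) size) ⟩
          s + α            ≡⟨ +-comm s α ⟩
          α + s            ∎
          where open ≤-Reasoning

        2≤α : 2 ≤ α
        2≤α = +-cancelʳ-≤ s 2 α (≤-trans high deg≤α+s)

        module _ {a h u} (a∈ : a ∈ misses v g) (u∈a : u ∈ˢ a) (u≢v : u ≢ v)
                 (h-edge : IsEdge h) (u∈h : u ∈ˢ h) (h≢a : h ≢ a) where

          private
            a-edge = proj₁ (proj₁ (∈-misses⁻ {v} {g} a∈))
            v∈a    = proj₂ (proj₁ (∈-misses⁻ {v} {g} a∈))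
            g∦a    = proj₂ (∈-misses⁻ {v} {g} a∈)
            v∉h : v ∉ˢ h
            v∉h v∈h = h≢a (same-edge h-edge a-edge u≢v u∈h u∈a v∈h v∈a)
            h-a : Meets h a
            h-a = u , u∈h , u∈a

          -- If `h` missed `g`, `hits-⊆` would give `h` every hit of `g` and the edge `a` besides,
          -- against maximality. For empty `g` the inclusion is vacuous: a hit supplies the point of
          -- `g` that `is-edge` asks for.
          crosses-g : Meets h g
          crosses-g = decidable-stable (Meets? h g) λ h∦g → <⇒≱ (length-⊂ (hits-unique v g)
            (λ b∈ → let _ , _ , y∈g , _ = ∈-hits⁻ {v} {g} b∈ in
               hits-⊆ a-edge (is-edge y∈g) h-edge v∈a h-a g∦a h∦g b∈)
            (λ a∈hits → g∦a (proj₂ (∈-hits⁻ {v} {g} a∈hits)))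
            (∈-hits⁺ a-edge v∈a h-a)) (maximal h-edge v∉h)

          -- Both `a` and `b` are missed by `g`. If `h`, which meets `a`, missed `b`, then
          -- `both-missed⇒disjoint` would separate it from `g`, contrary to `crosses-g`.
          crosses-missed : ∀ {b} → b ∈ misses v g → Meets h b
          crosses-missed {b} b∈ with (b-edge , v∈b) , g∦b ← ∈-misses⁻ {v} {g} b∈ =
            decidable-stable (Meets? h b) λ h∦b → both-missed⇒disjoint a-edge b-edge
              (is-edge (proj₂ (proj₂ crosses-g))) h-edge v∈a v∈b h-a h∦b g∦a g∦b crosses-g

          -- The point `y` of `h` on `g` lies on no missed edge, so `h` meets all `α` of them in its
          -- other `s - 1` points.
          crossing⇒α<s : α < s
          crossing⇒α<s with y , y∈h , y∈g ← crosses-g = begin-strict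
            α                      ≤⟨ length-⊆ {ys = hits v (h - y)} (misses-unique v g) (λ {b} b∈ →
              let (b-edge , v∈b) , g∦b = ∈-misses⁻ {v} {g} b∈ ; z , z∈h , z∈b = crosses-missed b∈
              in ∈-hits⁺ b-edge v∈b (z , x∈p∧x≢y⇒x∈p-y z∈h (λ { refl → g∦b (z , y∈g , z∈b) }) , z∈b)) ⟩
            length (hits v (h - y)) ≤⟨ hits≤ (λ v∈ → v∉h (x∈p-y⇒x∈p v∈)) ⟩
            ∣ h - y ∣              <⟨ x∈p⇒∣p-x∣<∣p∣ y∈h ⟩
            ∣ h ∣                  ≡⟨ uniform h h-edge ⟩
            s                      ∎
            where
            open ≤-Reasoning
            x∈p-y⇒x∈p : ∀ {x} → x ∈ˢ h - y → x ∈ˢ h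
            x∈p-y⇒x∈p = p─q⊆p h Subset.⁅ y ⁆

        -- By `2≤α` there is a second missed edge `b`, which avoids `u`. It meets `a` in `v`, and
        -- every other edge through `u` by `crosses-missed`.
        missed⇒deg≤s : ∀ {a u} → a ∈ misses v g → u ∈ˢ a → u ≢ v → deg u ≤ s
        missed⇒deg≤s {a} {u} a∈ u∈a u≢v
          with (a-edge , v∈a) , _ ← ∈-misses⁻ {v} {g} a∈
          with b , b∈ , b≢a ← another _≟ˢ_ (misses-unique v g) 2≤α a
          with (b-edge , v∈b) , _ ← ∈-misses⁻ {v} {g} b∈ =
          all-meet⇒deg≤s b-edge (λ u∈b → b≢a (same-edge b-edge a-edge u≢v u∈b u∈a v∈b v∈a)) meets
          where
          meets : ∀ {e} → IsEdge e → u ∈ˢ e → Meets b e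
          meets {e} e-edge u∈e with e ≟ˢ a
          ... | yes refl = v , v∈b , v∈a
          ... | no e≢a   = Meets-sym (crosses-missed a∈ u∈a u≢v e-edge u∈e e≢a b∈)

        missed⇒deg≤1 : s ≤ α → ∀ {a u} → a ∈ misses v g → u ∈ˢ a → u ≢ v → deg u ≤ 1
        missed⇒deg≤1 s≤α {a} {u} a∈ u∈a u≢v = length-⊆ {ys = a ∷ []} (star-unique u) λ {e} e∈ →
          let e-edge , u∈e = ∈-star⁻ e∈ in
          here (decidable-stable (e ≟ˢ a) λ e≢a →
            <⇒≱ (crossing⇒α<s a∈ u∈a u≢v e-edge u∈e e≢a) s≤α)

    -- Count the points on the edges through `v`: by linearity every other neighbour occurs once,
    -- while `v` occurs `deg v` times. The terms are arranged to avoid subtraction. The identity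
    -- yields the size of a component from the degree and, conversely, the degree from the size.
    neighbourhood-size : ∀ {s} → Uniform H s → ∀ {v C} → v ∈ˢ C → (∀ w → w ∈ˢ C ⇔ Adjacent H v w) →
                         deg v * s + 1 ≡ deg v + ∣ C ∣
    neighbourhood-size {s} uniform {v} {C} v∈C neighbours = begin
      deg v * s + 1
        ≡⟨ cong₂ _+_ ∑-star (sym (∑-≟ 1)) ⟩
      ∑ V (λ w → ∑ (star v) (λ e → 𝟙 (w ∈ˢ? e))) + ∑ V (λ w → 𝟙 (w Fin.≟ v) * 1)
        ≡⟨ ∑-+ V _ _ ⟨
      ∑ V (λ w → ∑ (star v) (λ e → 𝟙 (w ∈ˢ? e)) + 𝟙 (w Fin.≟ v) * 1)
        ≡⟨ ∑-cong V (λ {w} _ → pointwise w) ⟩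
      ∑ V (λ w → 𝟙 (w Fin.≟ v) * deg v + 𝟙 (w ∈ˢ? C))
        ≡⟨ ∑-+ V _ _ ⟩
      ∑ V (λ w → 𝟙 (w Fin.≟ v) * deg v) + ∑ V (λ w → 𝟙 (w ∈ˢ? C))
        ≡⟨ cong₂ _+_ (∑-≟ (deg v)) (sym (∣p∣≡∑ C)) ⟩
      deg v + ∣ C ∣ ∎
      where
      open ≡-Reasoning
      V : List Vertex
      V = allFin order
      ∑-≟ : ∀ k → ∑ V (λ w → 𝟙 (w Fin.≟ v) * k) ≡ k
      ∑-≟ k = trans (∑-*ʳ V _ k) (trans (cong (_* k)
        (∑-𝟙≡1 (Fin._≟ v) (allFin⁺ order) (∈-allFin v) refl λ _ _ x≡v y≡v → trans x≡v (sym y≡v)))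
        (*-identityˡ k))
      ∑-star : deg v * s ≡ ∑ V (λ w → ∑ (star v) (λ e → 𝟙 (w ∈ˢ? e)))
      ∑-star = begin
        deg v * s                                       ≡⟨ ∑-const (star v) s ⟨
        ∑ (star v) (λ _ → s)                            ≡⟨ ∑-cong (star v) (λ {e} e∈ →
          trans (sym (uniform e (proj₁ (∈-star⁻ {v} e∈)))) (∣p∣≡∑ e)) ⟩
        ∑ (star v) (λ e → ∑ V (λ w → 𝟙 (w ∈ˢ? e)))      ≡⟨ ∑-swap (star v) V _ ⟩
        ∑ V (λ w → ∑ (star v) (λ e → 𝟙 (w ∈ˢ? e)))      ∎
      pointwise : ∀ w → ∑ (star v) (λ e → 𝟙 (w ∈ˢ? e)) + 𝟙 (w Fin.≟ v) * 1 ≡ 𝟙 (w Fin.≟ v) * deg v + 𝟙 (w ∈ˢ? C)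
      pointwise w with w Fin.≟ v | w ∈ˢ? C
      ... | yes refl | no v∉C = contradiction v∈C v∉C
      ... | yes refl | yes _ = cong (_+ 1) (begin
        ∑ (star v) (λ e → 𝟙 (v ∈ˢ? e)) ≡⟨ ∑-cong (star v) (λ {e} e∈ → 𝟙-yes (v ∈ˢ? e) (proj₂ (∈-star⁻ {v} e∈))) ⟩
        ∑ (star v) (λ _ → 1)           ≡⟨ ∑-const (star v) 1 ⟩
        deg v * 1                      ≡⟨ *-comm (deg v) 1 ⟩
        1 * deg v                      ∎)
      ... | no w≢v | yes w∈C with e , e-edge , v∈e , w∈e ← Equivalence.to (neighbours w) w∈C =
        trans (+-identityʳ _) (∑-𝟙≡1 (w ∈ˢ?_) (star-unique v) (∈-star⁺ e-edge v∈e) w∈e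
          λ f∈ g∈ w∈f w∈g → let f-edge , v∈f = ∈-star⁻ {v} f∈ ; g-edge , v∈g = ∈-star⁻ {v} g∈
                            in same-edge f-edge g-edge w≢v w∈f w∈g v∈f v∈g)
      ... | no w≢v | no w∉C = trans (+-identityʳ _) (trans
        (∑-cong (star v) (λ {e} e∈ → 𝟙-no (w ∈ˢ? e) λ w∈e → let e-edge , v∈e = ∈-star⁻ {v} e∈ in
          w∉C (Equivalence.from (neighbours w) (e , e-edge , v∈e , w∈e))))
        (trans (∑-const (star v) 0) (*-zeroʳ (deg v))))

    -- Discharging and the edge bound

    module Discharging {k : ℕ} (1≤k : 1 ≤ k) (uniform : Uniform H (suc k)) (free : P₄-Free (suc k) H) where

      private
        s : ℕ
        s = suc k

      -- The amount v gives to the owner of each edge through v, in units of 1 / s;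
      -- it satisfies deg v * charge v ≤ s * (1 + s ∸ deg v) for deg v ≤ 1 + s.
      charge : Vertex → ℕ
      charge v = 𝟙 (deg v ≤? 1) * k + 𝟙 (deg v ≤? s)

      charge-pendant : ∀ {v} → deg v ≤ 1 → charge v ≡ s
      charge-pendant {v} d≤1
        rewrite 𝟙-yes (deg v ≤? 1) d≤1 | 𝟙-yes (deg v ≤? s) (≤-trans d≤1 (s≤s z≤n)) =
        trans (cong (_+ 1) (*-identityˡ k)) (+-comm k 1)

      charge-low : ∀ {v} → 1 < deg v → deg v ≤ s → charge v ≡ 1
      charge-low {v} 1<d d≤s
        rewrite 𝟙-no (deg v ≤? 1) (<⇒≱ 1<d) | 𝟙-yes (deg v ≤? s) d≤s = refl

      charge-high : ∀ {v} → s < deg v → charge v ≡ 0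
      charge-high {v} s<d
        rewrite 𝟙-no (deg v ≤? 1) (<⇒≱ (≤-trans (s≤s (s≤s z≤n)) s<d))
              | 𝟙-no (deg v ≤? s) (<⇒≱ s<d) = refl

      1≤charge : ∀ {v} → deg v ≤ s → 1 ≤ charge v
      1≤charge {v} d≤s = ≤-trans (≤-reflexive (sym (𝟙-yes (deg v ≤? s) d≤s))) (m≤n+m _ _)

      -- The edges through a vertex of high degree that are missed by its maximal crosser have this
      -- property. No crosser is mentioned, so ownership depends on `v` and `e` alone, and the
      -- degree conditions allow an edge only one owner.
      Owns : Vertex → Subset order → Set
      Owns v e = v ∈ˢ e × 2 + s ≤ deg v × (∀ w → w ∈ˢ e → w ≢ v → deg w ≤ s)

      Owns? : ∀ v e → Dec (Owns v e)
      Owns? v e = (v ∈ˢ? e) ×-dec (2 + s ≤? deg v) ×-dec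
        Fin.all? λ w → (w ∈ˢ? e) →-dec (¬? (w Fin.≟ v) →-dec (deg w ≤? s))

      owner-unique : ∀ {u v e} → Owns u e → Owns v e → u ≡ v
      owner-unique {u} {v} (u∈e , u-high , _) (_ , _ , rest) = decidable-stable (u Fin.≟ v)
        λ u≢v → <⇒≱ (≤-trans (n≤1+n _) u-high) (rest u u∈e u≢v)

      weight : Subset order → ℕ
      weight e = ∑ (elements e) charge

      income : Vertex → ℕ
      income v = ∑ edges λ e → 𝟙 (Owns? v e) * weight e

      -- The factor `k` counts the points of `e` other than `v`. Granting `v` an extra `m` on both
      -- sides makes the estimate uniform over all points of `e`.
      weight-bound : ∀ {v e} m → IsEdge e → v ∈ˢ e → (∀ {w} → w ∈ˢ e → w ≢ v → m ≤ charge w) →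
                     k * m ≤ weight e
      weight-bound {v} {e} m e-edge v∈e m≤charge = +-cancelˡ-≤ m (k * m) (weight e) $ begin
        s * m                                        ≡⟨ cong (_* m) (trans (length-elements e) (uniform e e-edge)) ⟨
        length (elements e) * m                      ≡⟨ ∑-const (elements e) m ⟨
        ∑ (elements e) (λ _ → m)                     ≤⟨ ∑-mono (elements e) pointwise ⟩
        ∑ (elements e) (λ w → 𝟙 (w Fin.≟ v) * m + charge w) ≡⟨ ∑-+ (elements e) _ charge ⟩
        ∑ (elements e) (λ w → 𝟙 (w Fin.≟ v) * m) + weight e ≡⟨ cong (_+ weight e) (∑-*ʳ (elements e) _ m) ⟩
        ∑ (elements e) (λ w → 𝟙 (w Fin.≟ v)) * m + weight e
          ≡⟨ cong (λ c → c * m + weight e) (∑-𝟙≡1 (Fin._≟ v) (elements-unique e) (∈-elements⁺ v∈e) refl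
               λ _ _ x≡v y≡v → trans x≡v (sym y≡v)) ⟩
        1 * m + weight e                             ≡⟨ cong (_+ weight e) (*-identityˡ m) ⟩
        m + weight e                                 ∎
        where
        open ≤-Reasoning
        pointwise : ∀ {w} → w ∈ elements e → m ≤ 𝟙 (w Fin.≟ v) * m + charge w
        pointwise {w} w∈ with w Fin.≟ v
        ... | yes _  = ≤-trans (≤-reflexive (sym (*-identityˡ m))) (m≤m+n _ _)
        ... | no w≢v = m≤charge (∈-elements⁻ w∈) w≢v

      income-bound : ∀ {v g} m → (∀ {a} → a ∈ misses v g → Owns v a × m ≤ weight a) →
                     length (misses v g) * m ≤ income v
      income-bound {v} {g} m owned = begin
        length (misses v g) * m       ≡⟨ ∑-const (misses v g) m ⟨
        ∑ (misses v g) (λ _ → m)      ≤⟨ ∑-mono (misses v g) pointwise ⟩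
        ∑ (misses v g) paid           ≤⟨ ∑-filter-≤ _ (star v) paid ⟩
        ∑ (star v) paid               ≤⟨ ∑-filter-≤ _ edges paid ⟩
        income v                      ∎
        where
        open ≤-Reasoning
        paid : Subset order → ℕ
        paid e = 𝟙 (Owns? v e) * weight e
        pointwise : ∀ {a} → a ∈ misses v g → m ≤ paid a
        pointwise {a} a∈ with owns , m≤ ← owned a∈ rewrite 𝟙-yes (Owns? v a) owns =
          ≤-trans m≤ (≤-reflexive (sym (*-identityˡ _)))

      -- All amounts are scaled by `s`. It suffices to compare `spending` with `budget` at each
      -- vertex: in the sum over all vertices the payments made cover the incomes received and
      -- cancel.
      spending : Vertex → ℕ
      spending v = s * deg v + deg v * charge v

      budget : Vertex → ℕ
      budget v = s * (1 + s) + income v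

      -- A vertex of high degree pays nothing, and by `deg≤α+s` its excess over `s * (1 + s)` is at
      -- most `s * (α - 1)`. The `α` missed edges, all owned by `v`, bring in more than that.
      -- Strictness excludes such vertices in the case of equality.
      spending<budget : ∀ {v} → 2 + s ≤ deg v → spending v < budget v
      spending<budget {v} high with g , crosser ← maximalCrosser uniform free v = begin-strict
        s * deg v + deg v * charge v ≡⟨ cong (λ c → s * deg v + deg v * c) (charge-high (≤-trans (n≤1+n _) high)) ⟩
        s * deg v + deg v * 0        ≡⟨ cong (s * deg v +_) (*-zeroʳ (deg v)) ⟩
        s * deg v + 0                ≡⟨ +-identityʳ _ ⟩
        s * deg v                    ≤⟨ *-monoʳ-≤ s deg≤α+s ⟩
        s * (α + s)                  <⟨ main (s ≤? α) ⟩
        s * (1 + s) + income v       ∎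
        where
        open ≤-Reasoning
        open HighDegree uniform free crosser high
        gain : ∀ m → (∀ {a w} → a ∈ misses v g → w ∈ˢ a → w ≢ v → m ≤ charge w) → α * (k * m) ≤ income v
        gain m m≤charge = income-bound {g = g} (k * m) λ a∈ →
          let (a-edge , v∈a) , _ = ∈-misses⁻ {v} {g} a∈ in
          (v∈a , high , λ _ → missed⇒deg≤s a∈) , weight-bound m a-edge v∈a (m≤charge a∈)
        main : Dec (s ≤ α) → s * (α + s) < s * (1 + s) + income v
        -- All points other than `v` on missed edges now have degree at most `1` and pay `s`, so
        -- each such edge yields `k * s`, hence at least `s`.
        main (yes s≤α) = begin-strict
          s * (α + s)                 ≡⟨ solve 2 (λ x y → x :* (y :+ x) := x :* x :+ y :* (con 1 :* x)) refl s α ⟩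
          s * s + α * (1 * s)         <⟨ +-mono-<-≤ (m<n+m (s * s) {s} (s≤s z≤n)) (*-monoʳ-≤ α (*-monoˡ-≤ s 1≤k)) ⟩
          (s + s * s) + α * (k * s)   ≡⟨ cong (_+ α * (k * s)) (*-suc s s) ⟨
          s * (1 + s) + α * (k * s)   ≤⟨ +-monoʳ-≤ (s * (1 + s)) (gain s λ a∈ w∈a w≢v →
            ≤-reflexive (sym (charge-pendant (missed⇒deg≤1 s≤α a∈ w∈a w≢v)))) ⟩
          s * (1 + s) + income v      ∎
        -- Each missed edge yields `k` at least, and `α * k` falls short of `α * s` only by `α`,
        -- which is less than `s`.
        main (no s≰α) = begin-strict
          s * (α + s)                 ≡⟨ solve 2 (λ x y → (con 1 :+ x) :* (y :+ (con 1 :+ x)) :=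
                                           y :+ ((con 1 :+ x) :* (con 1 :+ x) :+ y :* (x :* con 1))) refl k α ⟩
          α + (s * s + α * (k * 1))   <⟨ +-monoˡ-< _ (≰⇒> s≰α) ⟩
          s + (s * s + α * (k * 1))   ≡⟨ +-assoc s (s * s) _ ⟨
          (s + s * s) + α * (k * 1)   ≡⟨ cong (_+ α * (k * 1)) (*-suc s s) ⟨
          s * (1 + s) + α * (k * 1)   ≤⟨ +-monoʳ-≤ (s * (1 + s)) (gain 1 λ a∈ w∈a w≢v →
            1≤charge (missed⇒deg≤s a∈ w∈a w≢v)) ⟩
          s * (1 + s) + income v      ∎

      spending-low : ∀ {v} → deg v ≤ 1 + s → spending v ≤ s * (1 + s)
      spending-low {v} d≤1+s with deg v ≤? 1 | deg v ≤? s
      ... | yes d≤1 | _ = begin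
        s * deg v + deg v * charge v ≡⟨ cong (λ c → s * deg v + deg v * c) (charge-pendant d≤1) ⟩
        s * deg v + deg v * s        ≤⟨ +-mono-≤ (*-monoʳ-≤ s d≤1) (*-monoˡ-≤ s {deg v} {s} (≤-trans d≤1 (s≤s z≤n))) ⟩
        s * 1 + s * s                ≡⟨ *-distribˡ-+ s 1 s ⟨
        s * (1 + s)                  ∎
        where open ≤-Reasoning
      ... | no d≰1 | yes d≤s = begin
        s * deg v + deg v * charge v ≡⟨ cong (λ c → s * deg v + deg v * c) (charge-low (≰⇒> d≰1) d≤s) ⟩
        s * deg v + deg v * 1        ≡⟨ cong (s * deg v +_) (*-comm (deg v) 1) ⟩
        s * deg v + 1 * deg v        ≡⟨ *-distribʳ-+ (deg v) s 1 ⟨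
        (s + 1) * deg v              ≤⟨ *-monoʳ-≤ (s + 1) d≤s ⟩
        (s + 1) * s                  ≡⟨ *-comm (s + 1) s ⟩
        s * (s + 1)                  ≡⟨ cong (s *_) (+-comm s 1) ⟩
        s * (1 + s)                  ∎
        where open ≤-Reasoning
      ... | no _ | no d≰s = begin
        s * deg v + deg v * charge v ≡⟨ cong (λ c → s * deg v + deg v * c) (charge-high (≰⇒> d≰s)) ⟩
        s * deg v + deg v * 0        ≡⟨ cong (s * deg v +_) (*-zeroʳ (deg v)) ⟩
        s * deg v + 0                ≡⟨ +-identityʳ _ ⟩
        s * deg v                    ≤⟨ *-monoʳ-≤ s d≤1+s ⟩
        s * (1 + s)                  ∎
        where open ≤-Reasoning

      spending≤budget : ∀ v → spending v ≤ budget v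
      spending≤budget v with deg v ≤? 1 + s
      ... | yes d≤1+s = ≤-trans (spending-low d≤1+s) (m≤m+n _ _)
      ... | no d≰1+s  = <⇒≤ (spending<budget (≰⇒> d≰1+s))

      private
        V : List Vertex
        V = allFin order
        length-V : length V ≡ order
        length-V = length-tabulate {n = order} id
        transferred : ℕ
        transferred = ∑ V λ v → deg v * charge v

      -- Having at most one owner, an edge passes on its weight at most once. Payments on unowned
      -- edges are lost, hence an inequality.
      ∑-income : ∑ V income ≤ transferred
      ∑-income = begin
        ∑ V income                                           ≡⟨ ∑-swap V edges _ ⟩
        ∑ edges (λ e → ∑ V (λ v → 𝟙 (Owns? v e) * weight e)) ≡⟨ ∑-cong edges (λ {e} _ → ∑-*ʳ V _ (weight e)) ⟩
        ∑ edges (λ e → ∑ V (λ v → 𝟙 (Owns? v e)) * weight e) ≤⟨ ∑-mono edges (λ {e} _ → *-monoˡ-≤ (weight e)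
          (∑-𝟙≤1 (λ v → Owns? v e) (allFin⁺ order) λ _ _ → owner-unique)) ⟩
        ∑ edges (λ e → 1 * weight e)                         ≡⟨ ∑-cong edges (λ {e} _ → *-identityˡ (weight e)) ⟩
        ∑ edges weight                                       ≡⟨ ∑-incidence charge ⟩
        transferred                                          ∎
        where open ≤-Reasoning

      ∑-spending : ∑ V spending ≡ (s * ∣E∣ H) * s + transferred
      ∑-spending = trans (∑-+ V _ _) (cong (_+ transferred) (begin
        ∑ V (λ v → s * deg v) ≡⟨ ∑-cong V (λ {v} _ → *-comm s (deg v)) ⟩
        ∑ V (λ v → deg v * s) ≡⟨ ∑-*ʳ V deg s ⟩
        ∑ V deg * s           ≡⟨ cong (_* s) (∑-deg uniform) ⟩
        (s * ∣E∣ H) * s       ∎))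
        where open ≡-Reasoning

      ∑-budget : ∑ V budget ≤ (suc s * ∣V∣ H) * s + transferred
      ∑-budget = begin
        ∑ V budget                                ≡⟨ ∑-+ V _ income ⟩
        ∑ V (λ _ → s * (1 + s)) + ∑ V income      ≤⟨ +-monoʳ-≤ _ ∑-income ⟩
        ∑ V (λ _ → s * (1 + s)) + transferred     ≡⟨ cong (_+ transferred) (∑-const V (s * (1 + s))) ⟩
        length V * (s * (1 + s)) + transferred    ≡⟨ cong (λ l → l * (s * (1 + s)) + transferred) length-V ⟩
        order * (s * (1 + s)) + transferred       ≡⟨ cong (_+ transferred)
          (solve 2 (λ n s → n :* (s :* (con 1 :+ s)) := ((con 1 :+ s) :* n) :* s) refl order s) ⟩
        (suc s * ∣V∣ H) * s + transferred         ∎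
        where open ≤-Reasoning

      edge-bound : s * ∣E∣ H ≤ suc s * ∣V∣ H
      edge-bound = *-cancelʳ-≤ _ _ s $ +-cancelʳ-≤ transferred _ _ $ begin
        (s * ∣E∣ H) * s + transferred     ≡⟨ ∑-spending ⟨
        ∑ V spending                      ≤⟨ ∑-mono V (λ {v} _ → spending≤budget v) ⟩
        ∑ V budget                        ≤⟨ ∑-budget ⟩
        (suc s * ∣V∣ H) * s + transferred ∎
        where open ≤-Reasoning

      -- Tightness at each vertex excludes degrees above `suc s`, yet still permits degree `s`.
      -- Since the degrees average to `suc s`, none can then be smaller.
      extremal⇒regular : s * ∣E∣ H ≡ suc s * ∣V∣ H → ∀ v → deg v ≡ suc s
      extremal⇒regular extremal v = ∑-tight V (λ {u} _ → deg≤1+s u) (≤-reflexive ∑-1+s) (∈-allFin v)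
        where
        tight : ∀ u → spending u ≡ budget u
        tight u = ∑-tight V (λ {u} _ → spending≤budget u) (≤-trans ∑-budget (≤-reflexive
          (trans (cong (λ t → t * s + transferred) (sym extremal)) (sym ∑-spending)))) (∈-allFin u)
        deg≤1+s : ∀ u → deg u ≤ suc s
        deg≤1+s u = ≮⇒≥ λ high → <⇒≢ (spending<budget high) (tight u)
        ∑-1+s : ∑ V (λ _ → suc s) ≡ ∑ V deg
        ∑-1+s = begin
          ∑ V (λ _ → suc s) ≡⟨ ∑-const V (suc s) ⟩
          length V * suc s  ≡⟨ cong (_* suc s) length-V ⟩
          order * suc s     ≡⟨ *-comm order (suc s) ⟩
          suc s * order     ≡⟨ extremal ⟨
          s * ∣E∣ H         ≡⟨ ∑-deg uniform ⟨
          ∑ V deg           ∎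
          where open ≡-Reasoning

    -- The regular case

    module Regular {s : ℕ} (uniform : Uniform H s) (free : P₄-Free s H)
                   (regular : ∀ v → deg v ≡ suc s) where

      ∑-∩ : ∀ {p} → IsEdge p → ∑ edges (λ e → ∣ e ∩ p ∣) ≡ s * suc s
      ∑-∩ {p} p-edge = begin
        ∑ edges (λ e → ∣ e ∩ p ∣)
          ≡⟨ ∑-cong edges (λ {e} _ → ∣e∩p∣ e) ⟩
        ∑ edges (λ e → ∑ (elements e) (λ x → 𝟙 (x ∈ˢ? p)))
          ≡⟨ ∑-incidence (λ x → 𝟙 (x ∈ˢ? p)) ⟩
        ∑ (allFin order) (λ x → deg x * 𝟙 (x ∈ˢ? p))
          ≡⟨ ∑-cong (allFin order) (λ {x} _ → trans (*-comm (deg x) _) (cong (𝟙 (x ∈ˢ? p) *_) (regular x))) ⟩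
        ∑ (allFin order) (λ x → 𝟙 (x ∈ˢ? p) * suc s)
          ≡⟨ ∑-*ʳ (allFin order) _ (suc s) ⟩
        ∑ (allFin order) (λ x → 𝟙 (x ∈ˢ? p)) * suc s
          ≡⟨ cong (_* suc s) (trans (sym (∣p∣≡∑ p)) (uniform p p-edge)) ⟩
        s * suc s ∎
        where
        open ≡-Reasoning
        ∣e∩p∣ : ∀ e → ∣ e ∩ p ∣ ≡ ∑ (elements e) (λ x → 𝟙 (x ∈ˢ? p))
        ∣e∩p∣ e = begin
          ∣ e ∩ p ∣
            ≡⟨ ∣p∣≡∑ (e ∩ p) ⟩
          ∑ (allFin order) (λ x → 𝟙 (x ∈ˢ? (e ∩ p)))
            ≡⟨ ∑-cong (allFin order) (λ {x} _ → trans
                 (𝟙-cong (x ∈ˢ? (e ∩ p)) ((x ∈ˢ? e) ×-dec (x ∈ˢ? p)) (x∈p∩q⁻ e p) x∈p∩q⁺)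
                 (𝟙-× (x ∈ˢ? e) (x ∈ˢ? p))) ⟩
          ∑ (allFin order) (λ x → 𝟙 (x ∈ˢ? e) * 𝟙 (x ∈ˢ? p))
            ≡⟨ ∑-filter (_∈ˢ? e) (allFin order) _ ⟨
          ∑ (elements e) (λ x → 𝟙 (x ∈ˢ? p)) ∎

      -- Every edge is met by equally many edges, so the inclusion between
      -- the edges meeting p and those meeting q can be reversed.
      parallel-sym : ∀ {p q} → IsEdge p → IsEdge q → ¬ Meets p q →
        (∀ {e} → IsEdge e → e ≢ q → Meets e q → Meets e p) →
        ∀ {e} → IsEdge e → e ≢ p → Meets e p → Meets e q
      parallel-sym {p} {q} p-edge q-edge p∦q q⇒p {e₀} e₀-edge e₀≢p e₀-p =
        decidable-stable (Meets? e₀ q) λ e₀∦q → 0≢1+n (begin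
          0                                    ≡⟨ cong₂ _+_ (disjoint-size e₀∦q) (cong (_* s) (𝟙-no (e₀ ≟ˢ p) e₀≢p)) ⟨
          side q p e₀                          ≡⟨ ∑-tight edges pointwise (≤-reflexive (trans (total p-edge q-edge) (sym (total q-edge p-edge)))) e₀-edge ⟩
          side p q e₀                          ≡⟨ cong₂ _+_ (meet-size e₀-edge p-edge e₀≢p e₀-p)
                                                    (cong (_* s) (𝟙-no (e₀ ≟ˢ q) λ { refl → p∦q (Meets-sym e₀-p) })) ⟩
          1                                    ∎)
        where
        open ≡-Reasoning
        disjoint-size : ∀ {e f : Subset order} → ¬ Meets e f → ∣ e ∩ f ∣ ≡ 0
        disjoint-size {e} {f} e∦f = trans
          (cong ∣_∣ (Empty-unique {p = e ∩ f} λ (x , x∈) → e∦f (x , x∈p∩q⁻ e f x∈)))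
          (∣⊥∣≡0 order)
        -- The edge `p` contributes `s` to its own sum of intersections and nothing to that of the
        -- disjoint edge `q`. The second summand evens this out, so that the two sums, equal in
        -- total, compare term by term.
        side : Subset order → Subset order → Subset order → ℕ
        side p q e = ∣ e ∩ p ∣ + 𝟙 (e ≟ˢ q) * s
        total : ∀ {p q} → IsEdge p → IsEdge q → ∑ edges (side p q) ≡ s * suc s + 1 * s
        total {p} {q} p-edge q-edge = trans (∑-+ edges _ _) (cong₂ _+_ (∑-∩ p-edge)
          (trans (∑-*ʳ edges _ s) (cong (_* s)
            (∑-𝟙≡1 (_≟ˢ q) unique q-edge refl λ _ _ x≡q y≡q → trans x≡q (sym y≡q)))))
        pointwise : ∀ {e} → IsEdge e → side q p e ≤ side p q e
        pointwise {e} e-edge with e ≟ˢ p | e ≟ˢ q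
        ... | yes refl | yes refl = ≤-refl
        ... | yes refl | no _     = ≤-reflexive (trans (cong (_+ 1 * s) (disjoint-size p∦q))
          (trans (+-comm 0 _) (cong (_+ 0) (trans (*-identityˡ s)
            (sym (trans (cong ∣_∣ (∩-idem p)) (uniform p p-edge)))))))
        ... | no _     | yes refl = ≤-trans (≤-reflexive (+-identityʳ _))
          (≤-trans (∣p∩q∣≤∣q∣ q q) (≤-trans
            (≤-reflexive (trans (uniform q q-edge) (sym (*-identityˡ s)))) (m≤n+m _ ∣ q ∩ p ∣)))
        ... | no e≢p   | no e≢q with Meets? e q
        ...   | no e∦q = ≤-trans (≤-reflexive (cong (_+ 0) (disjoint-size e∦q))) z≤n
        ...   | yes e-q = ≤-reflexive (cong (_+ 0) (trans (meet-size e-edge q-edge e≢q e-q)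
          (sym (meet-size e-edge p-edge e≢p (q⇒p e-edge e≢q e-q)))))

      module _ {v p b} (p-edge : IsEdge p) (b-edge : IsEdge b) (v∈b : v ∈ˢ b) (p∦b : ¬ Meets p b)
               (misses≤1 : length (misses v p) ≤ 1) where

        meets-rest : ∀ {c} → IsEdge c → v ∈ˢ c → c ≢ b → Meets p c
        meets-rest {c} c-edge v∈c c≢b = decidable-stable (Meets? p c) λ p∦c → <⇒≱
          (length-⊆ {xs = c ∷ b ∷ []} ((c≢b ∷ []) ∷ [] ∷ []) λ
            { (here refl) → ∈-misses⁺ c-edge v∈c p∦c
            ; (there (here refl)) → ∈-misses⁺ b-edge v∈b p∦b })
          misses≤1

        -- By `parallel-sym` it suffices that every other edge `e` meeting `b` meets `p`. If `v` is
        -- on `e`, this is `meets-rest`. If `e` avoids `v` and misses `p`, then `hits-⊆` passes all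
        -- hits of `p` on to `e`, which would meet all `suc s` edges through `v` with only `s`
        -- points.
        parallel : ∀ {e} → IsEdge e → e ≢ p → Meets e p → Meets e b
        parallel = parallel-sym p-edge b-edge p∦b meets-b⇒meets-p
          where
          meets-b⇒meets-p : ∀ {e} → IsEdge e → e ≢ b → Meets e b → Meets e p
          meets-b⇒meets-p {e} e-edge e≢b e-b with v ∈ˢ? e
          ... | yes v∈e = Meets-sym (meets-rest e-edge v∈e e≢b)
          ... | no v∉e  = decidable-stable (Meets? e p) λ e∦p → <⇒≱
            (subst (s <_) (sym (regular v)) ≤-refl)
            (all-meet⇒deg≤s uniform free e-edge v∉e λ {c} c-edge v∈c → meets-all e∦p c-edge v∈c)
            where
            meets-all : ¬ Meets e p → ∀ {c} → IsEdge c → v ∈ˢ c → Meets e c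
            meets-all e∦p {c} c-edge v∈c with c ≟ˢ b
            ... | yes refl = e-b
            ... | no c≢b = proj₂ (∈-hits⁻ {v} {e} (hits-⊆ uniform free b-edge p-edge e-edge v∈b e-b p∦b e∦p
              (∈-hits⁺ c-edge v∈c (meets-rest c-edge v∈c c≢b))))

      missing-edge : ∀ {u f} → IsEdge f → u ∉ˢ f → ∃[ p ] p ∈ misses u f
      missing-edge {u} {f} f-edge u∉f = element (+-cancelˡ-≤ (length (hits u f)) 1 _ (begin
        length (hits u f) + 1                     ≤⟨ +-monoˡ-≤ 1 (hits≤ u∉f) ⟩
        ∣ f ∣ + 1                                 ≡⟨ trans (cong (_+ 1) (uniform f f-edge)) (+-comm s 1) ⟩
        suc s                                     ≡⟨ regular u ⟨
        deg u                                     ≡⟨ hits+misses≡deg u f ⟨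
        length (hits u f) + length (misses u f)   ∎))
        where open ≤-Reasoning

      -- The inductive step of `misses≤1`, by contradiction; `fewer⇒≤1` is the induction hypothesis.
      module TwoMisses {v a h x b b′}
        (a-edge : IsEdge a) (v∈a : v ∈ˢ a) (h-edge : IsEdge h) (v∉h : v ∉ˢ h) (x∈h : x ∈ˢ h) (x∈a : x ∈ˢ a)
        (b-edge : IsEdge b) (v∈b : v ∈ˢ b) (h∦b : ¬ Meets h b)
        (b′-edge : IsEdge b′) (v∈b′ : v ∈ˢ b′) (h∦b′ : ¬ Meets h b′) (b≢b′ : b ≢ b′)
        (fewer⇒≤1 : ∀ {p} → IsEdge p → v ∉ˢ p → Meets p b →
          length (misses v p) < length (misses v h) → length (misses v p) ≤ 1) where

        -- In an affine plane of order `s` these edges would be parallels of `b′`, and `Translates`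
        -- would be the projection of `b` onto `a` along them, fixing `v`.
        Transversal : Vertex → Subset order → Set
        Transversal u p = IsEdge p × u ∈ˢ p × ¬ Meets p b′ × ¬ Meets p h × length (misses v p) ≤ 1

        -- First `both-missed⇒disjoint` separates `p` from `h`. Then `hits-⊆` gives `p` every hit of
        -- `h`, and `b` is a further one, so the induction hypothesis applies to `p`.
        missing⇒transversal : ∀ {u p} → u ∈ˢ b → IsEdge p → u ∈ˢ p → ¬ Meets b′ p → Transversal u p
        missing⇒transversal {u} {p} u∈b p-edge u∈p b′∦p =
          p-edge , u∈p , b′∦p ∘ Meets-sym , p∦h , fewer⇒≤1 p-edge v∉p p-b fewer
          where
          p-b : Meets p b
          p-b = u , u∈p , u∈b
          v∉p : v ∉ˢ p
          v∉p v∈p = b′∦p (v , v∈b′ , v∈p)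
          p∦h : ¬ Meets p h
          p∦h = both-missed⇒disjoint uniform free b-edge b′-edge h-edge p-edge v∈b v∈b′
            p-b (b′∦p ∘ Meets-sym) h∦b h∦b′
          misses-⊆ : ∀ {c} → c ∈ misses v p → c ∈ misses v h
          misses-⊆ c∈ with (c-edge , v∈c) , p∦c ← ∈-misses⁻ {v} {p} c∈ =
            ∈-misses⁺ c-edge v∈c λ h-c → p∦c (proj₂ (∈-hits⁻ {v} {p}
              (hits-⊆ uniform free b-edge h-edge p-edge v∈b p-b h∦b p∦h (∈-hits⁺ c-edge v∈c h-c))))
          fewer : length (misses v p) < length (misses v h)
          fewer = length-⊂ (misses-unique v p) misses-⊆
            (λ b∈ → proj₂ (∈-misses⁻ {v} {p} b∈) p-b) (∈-misses⁺ b-edge v∈b h∦b)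

        transversal : ∀ {u} → u ∈ˢ b → u ≢ v → ∃ (Transversal u)
        transversal {u} u∈b u≢v
          with p , p∈ ← missing-edge b′-edge (λ u∈b′ → b≢b′ (same-edge b-edge b′-edge u≢v u∈b u∈b′ v∈b v∈b′))
          with (p-edge , u∈p) , b′∦p ← ∈-misses⁻ {u} {b′} p∈ = p , missing⇒transversal u∈b p-edge u∈p b′∦p

        Translates : Vertex → Vertex → Set
        Translates u y = (u ≡ v × y ≡ v) ⊎ (∃[ p ] Transversal u p × y ∈ˢ p)

        -- The image avoids `x` because `x` lies on `h`, whereas `v` does not and a transversal is
        -- disjoint from `h`. A transversal meets `a` since its only miss is `b′`, and `a` differs
        -- from `b′` because `h` meets `a`.
        translate : ∀ {u} → u ∈ˢ b → Dec (u ≡ v) → ∃[ y ] y ∈ˢ a - x × Translates u y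
        translate u∈b (yes u≡v) = v , x∈p∧x≢y⇒x∈p-y v∈a (λ { refl → v∉h x∈h }) , inj₁ (u≡v , refl)
        translate u∈b (no u≢v) =
          let p , t@(p-edge , _ , p∦b′ , p∦h , m≤1) = transversal u∈b u≢v
              y , y∈p , y∈a = meets-rest p-edge b′-edge v∈b′ p∦b′ m≤1 a-edge v∈a
                                (λ a≡b′ → h∦b′ (x , x∈h , subst (x ∈ˢ_) a≡b′ x∈a))
          in y , x∈p∧x≢y⇒x∈p-y y∈a (λ y≡x → p∦h (y , y∈p , subst (_∈ˢ h) (sym y≡x) x∈h)) , inj₂ (p , t , y∈p)

        -- Two different transversals cannot share `y`: by `parallel` the second would meet `b′`. A
        -- single transversal meets `b` only once, and none passes through `v`.
        translate-injective : ∀ {u u′ y} → u ∈ˢ b → u′ ∈ˢ b → Translates u y → Translates u′ y → u ≡ u′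
        translate-injective _ _ (inj₁ (u≡v , _)) (inj₁ (u′≡v , _)) = trans u≡v (sym u′≡v)
        translate-injective _ _ (inj₁ (_ , refl)) (inj₂ (_ , (_ , _ , p∦b′ , _) , v∈p)) = contradiction (v , v∈p , v∈b′) p∦b′
        translate-injective _ _ (inj₂ (_ , (_ , _ , p∦b′ , _) , v∈p)) (inj₁ (_ , refl)) = contradiction (v , v∈p , v∈b′) p∦b′
        translate-injective u∈b u′∈b (inj₂ (p , (p-edge , u∈p , p∦b′ , _ , m≤1) , y∈p))
                                     (inj₂ (p′ , (p′-edge , u′∈p′ , p′∦b′ , _) , y∈p′)) with p′ ≟ˢ p
        ... | yes refl = same-vertex p-edge b-edge (λ { refl → p∦b′ (v , v∈b , v∈b′) }) u∈p u∈b u′∈p′ u′∈b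
        ... | no p′≢p  = contradiction
          (parallel p-edge b′-edge v∈b′ p∦b′ m≤1 p′-edge p′≢p (_ , y∈p′ , y∈p)) p′∦b′

        impossible : ⊥
        impossible = <⇒≱ (begin-strict
          length (elements (a - x)) ≡⟨ length-elements (a - x) ⟩
          ∣ a - x ∣                 <⟨ x∈p⇒∣p-x∣<∣p∣ x∈a ⟩
          ∣ a ∣                     ≡⟨ trans (uniform a a-edge) (sym (uniform b b-edge)) ⟩
          ∣ b ∣                     ≡⟨ length-elements b ⟨
          length (elements b)       ∎)
          (length-injection Translates (elements-unique b) 
            (λ u∈ → let y , y∈ , t = translate (∈-elements⁻ u∈) (_ Fin.≟ v) in y , ∈-elements⁺ y∈ , t)
            λ u∈ u′∈ → translate-injective (∈-elements⁻ u∈) (∈-elements⁻ u′∈))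
          where open ≤-Reasoning

      -- Induction on the number of missed edges, with `bound` as fuel. The recursive call keeps `v`
      -- but lets `b` take the place of `a`.
      misses≤1 : ∀ {v a h} → IsEdge a → v ∈ˢ a → IsEdge h → v ∉ˢ h → Meets h a →
                 ∀ bound → length (misses v h) ≤ bound → length (misses v h) ≤ 1
      misses≤1 a-edge v∈a h-edge v∉h h-a zero m≤ = ≤-trans m≤ z≤n
      misses≤1 {v} {a} {h} a-edge v∈a h-edge v∉h (x , x∈h , x∈a) (suc bound) m≤ = ≮⇒≥ λ 2≤m →
        let b , b′ , b∈ , b′∈ , b≢b′ = distinct-pair (misses-unique v h) 2≤m
            (b-edge , v∈b) , h∦b = ∈-misses⁻ {v} {h} b∈
            (b′-edge , v∈b′) , h∦b′ = ∈-misses⁻ {v} {h} b′∈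
        in TwoMisses.impossible a-edge v∈a h-edge v∉h x∈h x∈a b-edge v∈b h∦b b′-edge v∈b′ h∦b′ b≢b′
             λ p-edge v∉p p-b fewer → misses≤1 b-edge v∈b p-edge v∉p p-b bound (s≤s⁻¹ (≤-trans fewer m≤))

      -- If `y` were no neighbour of `v`, all hits would occur in the other `s - 1` points of `h`.
      -- But at most one of the `suc s` edges through `v` is missed.
      covered : ∀ {v a h} → IsEdge a → v ∈ˢ a → IsEdge h → v ∉ˢ h → Meets h a →
                ∀ {y} → y ∈ˢ h → Adjacent H v y
      covered {v} {a} {h} a-edge v∈a h-edge v∉h h-a {y} y∈h = decidable-stable (Adjacent? v y) λ v≁y →
        <⇒≱ (begin-strict
          length (hits v h)        ≤⟨ length-⊆ {ys = hits v (h - y)} (hits-unique v h) (λ e∈ →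
            let (e-edge , v∈e) , z , z∈h , z∈e = ∈-hits⁻ {v} {h} e∈ in
            ∈-hits⁺ e-edge v∈e (z , x∈p∧x≢y⇒x∈p-y z∈h (λ { refl → v≁y (_ , e-edge , v∈e , z∈e) }) , z∈e)) ⟩
          length (hits v (h - y))  ≤⟨ hits≤ (λ v∈ → v∉h (p─q⊆p h Subset.⁅ y ⁆ v∈)) ⟩
          ∣ h - y ∣                <⟨ x∈p⇒∣p-x∣<∣p∣ y∈h ⟩
          ∣ h ∣                    ≡⟨ uniform h h-edge ⟩
          s                        ∎)
        (+-cancelʳ-≤ 1 s _ (begin
          s + 1                    ≡⟨ trans (+-comm s 1) (sym (regular v)) ⟩
          deg v                    ≡⟨ hits+misses≡deg v h ⟨
          length (hits v h) + length (misses v h)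
            ≤⟨ +-monoʳ-≤ (length (hits v h)) (misses≤1 a-edge v∈a h-edge v∉h h-a _ ≤-refl) ⟩
          length (hits v h) + 1    ∎))
        where open ≤-Reasoning

      Adjacent-refl : ∀ v → Adjacent H v v
      Adjacent-refl v with e , e∈ ← element (subst (1 ≤_) (sym (regular v)) (s≤s z≤n))
        with e-edge , v∈e ← ∈-star⁻ {v} e∈ = e , e-edge , v∈e , v∈e

      Adjacent-trans : ∀ {u v w} → Adjacent H u v → Adjacent H v w → Adjacent H u w
      Adjacent-trans {u} {v} (e , e-edge , u∈e , v∈e) (h , h-edge , v∈h , w∈h) with u ∈ˢ? h
      ... | yes u∈h = h , h-edge , u∈h , w∈h
      ... | no u∉h  = covered e-edge u∈e h-edge u∉h (v , v∈h , v∈e) w∈h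

      Connected⇒Adjacent : ∀ {u v} → Connected H u v → Adjacent H u v
      Connected⇒Adjacent = Star.fold (Adjacent H) Adjacent-trans (Adjacent-refl _)

      component-Steiner : ∀ C → IsComponent H C → IsSteiner₂ s (s ^ 2) C (EdgeWithin H C)
      component-Steiner C ((v , v∈C) , closed) = record
        { points     = ∣C∣
        ; block⊆     = λ _ → proj₂
        ; block-size = λ b → uniform b ∘ proj₁
        ; pair       = λ {x} {y} x∈C y∈C x≢y →
            let e , e-edge , x∈e , y∈e = Connected⇒Adjacent (Equivalence.to (closed x∈C y) y∈C)
            in e , ((e-edge , λ {z} z∈e → Equivalence.from (closed x∈C z) ((e , e-edge , x∈e , z∈e) ◅ ε)) , x∈e , y∈e)
                 , λ ((f-edge , _) , x∈f , y∈f) → same-edge e-edge f-edge x≢y x∈e x∈f y∈e y∈f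
        }
        where
        ∣C∣ : ∣ C ∣ ≡ s ^ 2
        ∣C∣ = +-cancelˡ-≡ (suc s) _ _ (begin
          suc s + ∣ C ∣   ≡⟨ cong (_+ ∣ C ∣) (regular v) ⟨
          deg v + ∣ C ∣   ≡⟨ neighbourhood-size uniform v∈C
            (λ w → mk⇔ (Connected⇒Adjacent ∘ Equivalence.to (closed v∈C w))
                       (λ v~w → Equivalence.from (closed v∈C w) (v~w ◅ ε))) ⟨
          deg v * s + 1   ≡⟨ cong (λ d → d * s + 1) (regular v) ⟩
          suc s * s + 1   ≡⟨ solve 1 (λ x → (con 1 :+ x) :* x :+ con 1 := (con 1 :+ x) :+ (x :* (x :* con 1))) refl s ⟩
          suc s + s ^ 2   ∎)
          where open ≡-Reasoning

  -- Components

  Connected-sym : ∀ {u v} → Connected H u v → Connected H v u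
  Connected-sym = Star.reverse λ (e , e-edge , u∈e , v∈e) → e , e-edge , v∈e , u∈e

  -- Each round adds a vertex adjacent to `C`, so `order ≤ fuel + ∣ C ∣` persists. With the fuel
  -- spent, `C` has `order` points already and cannot grow.
  grow-component : ∀ {v} fuel C → v ∈ˢ C → (∀ {w} → w ∈ˢ C → Connected H v w) → order ≤ fuel + ∣ C ∣ →
                   ∃[ D ] v ∈ˢ D × (∀ w → w ∈ˢ D ⇔ Connected H v w)
  grow-component {v} fuel C v∈C reached bound
    with Fin.any? (λ u → Fin.any? λ w → (u ∈ˢ? C) ×-dec (¬? (w ∈ˢ? C)) ×-dec Adjacent? u w)
  ... | no closed = C , v∈C , λ w → mk⇔ reached (stays v∈C)
    where
    stays : ∀ {u w} → u ∈ˢ C → Connected H u w → w ∈ˢ C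
    stays u∈C ε = u∈C
    stays u∈C (_◅_ {j = w} u~w w↝) = stays
      (decidable-stable (w ∈ˢ? C) λ w∉C → closed (_ , w , u∈C , w∉C , u~w)) w↝
  ... | yes (u , w , u∈C , w∉C , u~w) = extend fuel bound
    where
    C′ : Subset order
    C′ = C ∪ ⁅ w ⁆
    ∣C∣<∣C′∣ : ∣ C ∣ < ∣ C′ ∣
    ∣C∣<∣C′∣ = p⊂q⇒∣p∣<∣q∣ (p⊆p∪q ⁅ w ⁆ , w , q⊆p∪q C ⁅ w ⁆ (x∈⁅x⁆ w) , w∉C)
    reached′ : ∀ {x} → x ∈ˢ C′ → Connected H v x
    reached′ x∈ with x∈p∪q⁻ C ⁅ w ⁆ x∈
    ... | inj₁ x∈C = reached x∈C
    ... | inj₂ x∈w = subst (Connected H v) (sym (x∈⁅y⁆⇒x≡y w x∈w)) (reached u∈C ◅◅ (u~w ◅ ε))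
    extend : ∀ fuel → order ≤ fuel + ∣ C ∣ → ∃[ D ] v ∈ˢ D × (∀ w → w ∈ˢ D ⇔ Connected H v w)
    extend zero    bound = contradiction (≤-trans ∣C∣<∣C′∣ (∣p∣≤n C′)) (≤⇒≯ bound)
    extend (suc f) bound = grow-component f C′ (p⊆p∪q ⁅ w ⁆ v∈C) reached′
      (≤-trans (≤-trans bound (≤-reflexive (sym (+-suc f ∣ C ∣)))) (+-monoʳ-≤ f ∣C∣<∣C′∣))

  component : ∀ v → ∃[ C ] v ∈ˢ C × (∀ w → w ∈ˢ C ⇔ Connected H v w)
  component v = grow-component order ⁅ v ⁆ (x∈⁅x⁆ v)
    (λ w∈ → subst (Connected H v) (sym (x∈⁅y⁆⇒x≡y v w∈)) ε) (m≤m+n order _)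

  component-IsComponent : ∀ {v C} → v ∈ˢ C → (∀ w → w ∈ˢ C ⇔ Connected H v w) → IsComponent H C
  component-IsComponent {v} v∈C C-reached = (v , v∈C) , λ {u} u∈C w → mk⇔
    (λ w∈C → Connected-sym (Equivalence.to (C-reached u) u∈C) ◅◅ Equivalence.to (C-reached w) w∈C)
    (λ u↝w → Equivalence.from (C-reached w) (Equivalence.to (C-reached u) u∈C ◅◅ u↝w))

  -- Regularity and the case of equality

  not-isolated : NoIsolatedVertices H → ∀ v → ∃[ e ] IsEdge e × v ∈ˢ e
  not-isolated no-isolated v = find (decidable-stable (Any.any? (v ∈ˢ?_) edges) λ none →
    no-isolated v λ e e-edge v∈e → none (lose e-edge v∈e))

  regular⇒no-isolated : ∀ {d} → (∀ v → deg v ≡ suc d) → NoIsolatedVertices H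
  regular⇒no-isolated regular v isolated
    with e , e∈ ← element (subst (1 ≤_) (sym (regular v)) (s≤s z≤n))
    with e-edge , v∈e ← ∈-star⁻ {v} e∈ = isolated e e-edge v∈e

  regular⇒extremal : ∀ {s} → Uniform H s → (∀ v → deg v ≡ suc s) → s * ∣E∣ H ≡ suc s * ∣V∣ H
  regular⇒extremal {s} uniform regular = begin
    s * ∣E∣ H                     ≡⟨ ∑-deg uniform ⟨
    ∑ (allFin order) deg          ≡⟨ ∑-cong (allFin order) (λ {v} _ → regular v) ⟩
    ∑ (allFin order) (λ _ → suc s) ≡⟨ ∑-const (allFin order) (suc s) ⟩
    length (allFin order) * suc s ≡⟨ cong (_* suc s) (length-tabulate {n = order} id) ⟩
    order * suc s                 ≡⟨ *-comm order (suc s) ⟩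
    suc s * ∣V∣ H                 ∎
    where open ≡-Reasoning

  -- The edge through `v` makes its component a Steiner system, where any two points share a block.
  -- So the component is the neighbourhood of `v`, and `neighbourhood-size` becomes a linear
  -- equation for the degree.
  Steiner⇒regular : ∀ {k} → 1 ≤ k → Linear H → Uniform H (suc k) → NoIsolatedVertices H →
    (∀ C → IsComponent H C → ContainsEdge H C → IsSteiner₂ (suc k) (suc k ^ 2) C (EdgeWithin H C)) →
    ∀ v → deg v ≡ suc (suc k)
  Steiner⇒regular {k} 1≤k linear uniform no-isolated steiner v =
    let C , v∈C , C-reached = component v
        e , e-edge , v∈e = not-isolated no-isolated v
        open IsSteiner₂ (steiner C (component-IsComponent v∈C C-reached)
          (e , e-edge , λ {w} w∈e → Equivalence.from (C-reached w) ((e , e-edge , v∈e , w∈e) ◅ ε)))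
        adjacent : ∀ {w} → w ∈ˢ C → Dec (v ≡ w) → Adjacent H v w
        adjacent w∈C = λ
          { (yes v≡w) → e , e-edge , v∈e , subst (_∈ˢ e) v≡w v∈e
          ; (no v≢w)  → let f , ((f-edge , _) , v∈f , w∈f) , _ = pair v∈C w∈C v≢w in f , f-edge , v∈f , w∈f }
    in solve-deg (deg v) (trans
         (neighbourhood-size linear uniform v∈C λ w → mk⇔ (λ w∈C → adjacent w∈C (v Fin.≟ w))
           (λ v~w → Equivalence.from (C-reached w) (v~w ◅ ε)))
         (cong (deg v +_) points))
    where
    solve-deg : ∀ d → d * suc k + 1 ≡ d + suc k ^ 2 → d ≡ suc (suc k)
    -- Removing `d + 1` from both sides leaves `d * k ≡ (2 + k) * k`, and `k` is positive because
    -- the uniformity is at least two.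
    solve-deg d eq = *-cancelʳ-≡ d (2 + k) k {{>-nonZero 1≤k}} (+-cancelˡ-≡ (d + 1) _ _ (begin
      (d + 1) + d * k           ≡⟨ solve 2 (λ d k → (d :+ con 1) :+ d :* k := d :* (con 1 :+ k) :+ con 1) refl d k ⟩
      d * suc k + 1             ≡⟨ eq ⟩
      d + suc k ^ 2             ≡⟨ solve 2 (λ d k → d :+ (con 1 :+ k) :* ((con 1 :+ k) :* con 1) :=
                                     (d :+ con 1) :+ (con 2 :+ k) :* k) refl d k ⟩
      (d + 1) + (2 + k) * k     ∎))
      where open ≡-Reasoning

-- Clearing denominators in ℚ

open import Data.Integer using (+_)

module _ (k a n e : ℕ) where
  private
    -- Elements of `ℚ` are kept in lowest terms, so cross-multiplication is done on unreduced
    -- fractions. `mkℚᵘ` takes the denominator less one: `0` stands for `1`, and `k` for `suc k`.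
    lhs-≃ : toℚᵘ (+ e / 1) ℚᵘ.≃ mkℚᵘ (+ e) 0
    lhs-≃ = toℚᵘ-fromℚᵘ (mkℚᵘ (+ e) 0)

    rhs-≃ : toℚᵘ ((+ a / suc k) ℚ.* (+ n / 1)) ℚᵘ.≃ mkℚᵘ (+ a) k ℚᵘ.* mkℚᵘ (+ n) 0
    rhs-≃ = ℚᵘ.≃-trans (toℚᵘ-homo-* (+ a / suc k) (+ n / 1))
      (ℚᵘ.*-cong (toℚᵘ-fromℚᵘ (mkℚᵘ (+ a) k)) (toℚᵘ-fromℚᵘ (mkℚᵘ (+ n) 0)))

    lhs-cross : + (suc k * e) ≡ + e ℤ.* + (suc k * 1)
    lhs-cross = trans (cong +_ (trans (*-comm (suc k) e) (cong (e *_) (sym (*-identityʳ (suc k))))))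
      (ℤ.pos-* e (suc k * 1))

    rhs-cross : + (a * n) ≡ (+ a ℤ.* + n) ℤ.* + 1
    rhs-cross = trans (ℤ.pos-* a n) (sym (ℤ.*-identityʳ _))

  cross-≤ : suc k * e ≤ a * n → (+ e / 1) ℚ.≤ (+ a / suc k) ℚ.* (+ n / 1)
  cross-≤ le = toℚᵘ-cancel-≤ (ℚᵘ.≤-respˡ-≃ (ℚᵘ.≃-sym lhs-≃) (ℚᵘ.≤-respʳ-≃ (ℚᵘ.≃-sym rhs-≃)
    (ℚᵘ.*≤* (subst₂ ℤ._≤_ lhs-cross rhs-cross (ℤ.+≤+ le)))))

  cross-≡ : (+ e / 1) ≡ (+ a / suc k) ℚ.* (+ n / 1) ⇔ suc k * e ≡ a * n
  cross-≡ = mk⇔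
    (λ eq → ℤ.+-injective (trans lhs-cross (trans
      (ℚᵘ.drop-*≡* (ℚᵘ.≃-trans (ℚᵘ.≃-sym lhs-≃) (ℚᵘ.≃-trans (toℚᵘ-cong eq) rhs-≃))) (sym rhs-cross))))
    (λ eq → toℚᵘ-injective (ℚᵘ.≃-trans lhs-≃ (ℚᵘ.≃-trans
      (ℚᵘ.*≡* (trans (sym lhs-cross) (trans (cong +_ eq) rhs-cross))) (ℚᵘ.≃-sym rhs-≃))))

corollary2p8 : (s : ℕ) (2≤s : 2 ≤ s) (H : Hypergraph) →
    Uniform H s → Linear H → P₄-Free s H →
    let instance s≢0 = >-nonZero (<⇒≤ 2≤s)
        E = + ∣E∣ H / 1
        bound = (+ suc s / s) ℚ.* (+ ∣V∣ H / 1)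
    in (E ℚ.≤ bound) ×
       ((E ≡ bound) ⇔
         (NoIsolatedVertices H ×
          (∀ C → IsComponent H C → ContainsEdge H C →
            IsSteiner₂ s (s ^ 2) C (EdgeWithin H C))))
corollary2p8 (suc k) (s≤s 1≤k) H uniform linear free =
  -- Here `s` is `suc k`, so the numerator `suc s` is `2 + k`.
  cross-≤ k (2 + k) (∣V∣ H) (∣E∣ H) edge-bound ,
  mk⇔
    (λ eq → let regular = extremal⇒regular (Equivalence.to cross eq)
                open Regular H linear uniform free regular
            in regular⇒no-isolated H regular , λ C C-component _ → component-Steiner C C-component)
    (λ (no-isolated , steiner) → Equivalence.from cross
      (regular⇒extremal H uniform (Steiner⇒regular H 1≤k linear uniform no-isolated steiner)))
  where
  open Discharging H linear 1≤k uniform free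
  cross = cross-≡ k (2 + k) (∣V∣ H) (∣E∣ H)
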